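{- Let $V$ be a model of set theory, let $X\in V$ be an infinite set, let $\mathscr{L}\in V$ be a relational language, and let $\mathbf{K}$ be (in $V$) a non-trivial strong Fraïssé class of finite $\mathscr{L}$-structures. If $G$ is generic for $\mathfrak{C}_X(\mathbf{K})$ over $V$, then there is an $H\in V[G]$ which is generic over $V$ for the Cohen forcing $\mathbb{C}[X]$.
   Context: A model of set theory is a transitive model of ZFC. Fraïssé classes: let $\mathbf{K}$ be a collection of finite $\mathscr{L}$-structures closed under isomorphism. $\mathbf{K}$ has HP if every substructure of a member is a member. It has JEP if any two members embed in a common member. It has the strong amalgamation property SAP if for all $\mathcal{M}_0,\mathcal{M}_1,\mathcal{M}_2\in\mathbf{K}$ and embeddings $i_1:\mathcal{M}_0\to\mathcal{M}_1$, $i_2:\mathcal{M}_0\to\mathcal{M}_2$ there are $\mathcal{M}_3\in\mathbf{K}$ and embeddings $j_1:\mathcal{M}_1\to\mathcal{M}_3$, $j_2:\mathcal{M}_2\to\mathcal{M}_3$ with $j_1\circ i_1=j_2\circ i_2$ and $j_1[M_1]\cap j_2[M_2]=(j_1\circ i_1)[M_0]$. A strong Fraïssé class is such a $\mathbf{K}$ with HP, JEP and SAP. An $\mathscr{L}$-literal is an atomic $\mathscr{L}$-formula or a (possibly iterated) negation of one; its arity is its number of free variables. A strong Fraïssé class $\mathbf{K}$ is trivial if for every literal $\psi$, say of arity $n$, either for all $\mathcal{A}\in\mathbf{K}$ the formula $\psi$ holds of every $n$-tuple of pairwise distinct elements of $\mathcal{A}$, or for all $\mathcal{A}\in\mathbf{K}$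 the formula $\neg\psi$ holds of every $n$-tuple of pairwise distinct elements of $\mathcal{A}$. Non-trivial means not trivial. $\mathfrak{C}_X(\mathbf{K})$ is the partial order of all elements of $\mathbf{K}$ whose underlying set is a (finite) subset of $X$, with $\mathcal{A}\le\mathcal{B}$ ($\mathcal{A}$ stronger) iff $\mathcal{B}$ is a substructure of $\mathcal{A}$. $\mathbb{C}[X]$ is the partial order of finite partial functions from $X$ to $\{0,1\}$, ordered by reverse inclusion. "Generic over $V$" means a generic filter over $V$ for the indicated partial order. -}

module Defs where

open import Level using (Lift; 0ℓ) renaming (suc to lsuc)
open import Data.Bool using (Bool; if_then_else_)
open import Data.Empty using (⊥)
open import Data.Fin using (Fin; toℕ)
open import Data.Maybe using (Maybe; maybe′)
open import Data.Nat using (ℕ; zero; suc)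
open import Data.Product using (Σ; Σ-syntax; ∃; ∃-syntax; _×_; _,_)
open import Data.Sum using (_⊎_)
open import Data.Vec using (Vec; _∷_; lookup)
open import Data.Vec.Relation.Unary.All using (All)
open import Function using (_∘_)
open import Function.Bundles using (_⇔_)
open import Relation.Binary.PropositionalEquality using (_≡_)
open import Relation.Nullary using (¬_)

infix 4 _≈_ _∈_ _⊆_

-- The ambient universe of sets is Aczel's type of well-founded sets;
-- set equality is bisimilarity.

data 𝕍 : Set₁ where
  sup : (A : Set) → (A → 𝕍) → 𝕍

_≈_ : 𝕍 → 𝕍 → Set
sup A f ≈ sup B g =
  (∀ a → ∃[ b ] f a ≈ g b) × (∀ b → ∃[ a ] f a ≈ g b)

_∈_ : 𝕍 → 𝕍 → Set
x ∈ sup B g = ∃[ b ] x ≈ g b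

_⊆_ : 𝕍 → 𝕍 → Set₁
x ⊆ y = ∀ z → z ∈ x → z ∈ y

｛_,_｝ : 𝕍 → 𝕍 → 𝕍
｛ x , y ｝ = sup Bool λ b → if b then x else y

⟨_,_⟩ : 𝕍 → 𝕍 → 𝕍
⟨ x , y ⟩ = ｛ ｛ x , x ｝ , ｛ x , y ｝ ｝

∅ : 𝕍
∅ = sup ⊥ λ ()

-- x ∪ {x}
S : 𝕍 → 𝕍
S x@(sup A f) = sup (Maybe A) (maybe′ f x)

nat : ℕ → 𝕍
nat zero    = ∅
nat (suc n) = S (nat n)

-- An n-tuple is coded as a function with domain the von Neumann numeral n.
tuple : ∀ {n} → (Fin n → 𝕍) → 𝕍
tuple {n} v = sup (Fin n) λ i → ⟨ nat (toℕ i) , v i ⟩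

-- The enumeration may repeat elements.
Finite : 𝕍 → Set₁
Finite x = Σ[ n ∈ ℕ ] Σ[ v ∈ (Fin n → 𝕍) ] x ≈ sup (Fin n) v

record IsFunction (f A B : 𝕍) : Set₁ where
  field
    graph      : ∀ e → e ∈ f → ∃[ x ] ∃[ y ] (x ∈ A × y ∈ B × e ≈ ⟨ x , y ⟩)
    total      : ∀ x → x ∈ A → ∃[ y ] ⟨ x , y ⟩ ∈ f
    functional : ∀ x y z → ⟨ x , y ⟩ ∈ f → ⟨ x , z ⟩ ∈ f → y ≈ z

-- First-order formulas of the language {∈, =}, with de Bruijn indices:
-- index zero refers to the innermost quantifier.

data Formula (n : ℕ) : Set where
  _∈′_ _≈′_      : Fin n → Fin n → Formula n
  ⊥′             : Formula n
  _∧′_ _∨′_ _⇒′_ : Formula n → Formula n → Formula n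
  ∀′ ∃′          : Formula (suc n) → Formula n

-- A class of sets, regarded as an ∈-structure.
Class : Set₂
Class = 𝕍 → Set₁

Sat : Class → ∀ {n} → Formula n → Vec 𝕍 n → Set₁
Sat V (i ∈′ j) ρ = Lift (lsuc 0ℓ) (lookup ρ i ∈ lookup ρ j)
Sat V (i ≈′ j) ρ = Lift (lsuc 0ℓ) (lookup ρ i ≈ lookup ρ j)
Sat V ⊥′       ρ = Lift (lsuc 0ℓ) ⊥
Sat V (φ ∧′ ψ) ρ = Sat V φ ρ × Sat V ψ ρ
Sat V (φ ∨′ ψ) ρ = Sat V φ ρ ⊎ Sat V ψ ρ
Sat V (φ ⇒′ ψ) ρ = Sat V φ ρ → Sat V ψ ρ
Sat V (∀′ φ)   ρ = ∀ x → V x → Sat V φ (x ∷ ρ)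
Sat V (∃′ φ)   ρ = ∃[ x ] (V x × Sat V φ (x ∷ ρ))

-- The axioms of ZFC relativised to V, the two schemes ranging over formulas
-- with parameters from V.  In `choice`, pairs are those of the ambient
-- universe; for transitive V satisfying `pairing` they agree with those of V.

record ZFC (V : Class) : Set₁ where
  field
    extensionality :
      ∀ x y → V x → V y → (∀ z → V z → (z ∈ x ⇔ z ∈ y)) → x ≈ y
    foundation :
      ∀ x → V x → (∃[ y ] (V y × y ∈ x)) →
      ∃[ y ] (V y × y ∈ x × (∀ z → V z → z ∈ y → ¬ z ∈ x))
    pairing :
      ∀ x y → V x → V y → ∃[ p ] (V p × (∀ z → V z → (z ∈ p ⇔ (z ≈ x ⊎ z ≈ y))))
    union :
      ∀ x → V x →
      ∃[ u ] (V u × (∀ z → V z → (z ∈ u ⇔ (∃[ y ] (V y × y ∈ x × z ∈ y)))))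
    powerset :
      ∀ x → V x →
      ∃[ p ] (V p × (∀ y → V y → (y ∈ p ⇔ (∀ z → V z → z ∈ y → z ∈ x))))
    infinity :
      ∃[ w ] (V w
        × (∃[ e ] (V e × e ∈ w × (∀ z → V z → ¬ z ∈ e)))
        × (∀ x → V x → x ∈ w →
             ∃[ y ] (V y × y ∈ w × (∀ z → V z → (z ∈ y ⇔ (z ∈ x ⊎ z ≈ x))))))
    separation :
      ∀ {n} (φ : Formula (suc n)) (ρ : Vec 𝕍 n) → All V ρ →
      ∀ x → V x →
      ∃[ y ] (V y × (∀ z → V z → (z ∈ y ⇔ (z ∈ x × Sat V φ (z ∷ ρ)))))
    replacement :
      ∀ {n} (φ : Formula (suc (suc n))) (ρ : Vec 𝕍 n) → All V ρ →
      ∀ x → V x →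
      (∀ y → V y → y ∈ x →
         ∃[ z ] (V z × Sat V φ (z ∷ y ∷ ρ)
                   × (∀ z′ → V z′ → Sat V φ (z′ ∷ y ∷ ρ) → z′ ≈ z))) →
      ∃[ r ] (V r × (∀ z → V z →
                (z ∈ r ⇔ (∃[ y ] (V y × y ∈ x × Sat V φ (z ∷ y ∷ ρ))))))
    choice :
      ∀ x → V x → (∀ y → V y → y ∈ x → ∃[ z ] (V z × z ∈ y)) →
      ∃[ f ] (V f × (∀ y → V y → y ∈ x →
                ∃[ z ] (V z × z ∈ y × ⟨ y , z ⟩ ∈ f
                          × (∀ z′ → V z′ → ⟨ y , z′ ⟩ ∈ f → z′ ≈ z))))

record IsTransitiveModel (V : Class) : Set₁ where
  field
    respects   : ∀ x y → x ≈ y → V x → V y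
    transitive : ∀ x y → V x → y ∈ x → V y
    zfc        : ZFC V

-- K is a class of the model V: a subclass of V that is definable over (V, ∈)
-- from parameters in V.
IsClassOf : Class → Class → Set₁
IsClassOf V K =
  (∀ x → K x → V x) ×
  Σ[ n ∈ ℕ ] Σ[ φ ∈ Formula (suc n) ] Σ[ ρ ∈ Vec 𝕍 n ]
    (All V ρ × (∀ x → V x → (K x ⇔ Sat V φ (x ∷ ρ))))

-- A relational language is a set of pairs ⟨ R , k ⟩, the arity k being a
-- function of the symbol R.

record IsLanguage (L : 𝕍) : Set₁ where
  field
    symbols : ∀ e → e ∈ L → Σ[ R ∈ 𝕍 ] Σ[ k ∈ ℕ ] e ≈ ⟨ R , nat k ⟩
    arity   : ∀ R j k → ⟨ R , nat j ⟩ ∈ L → ⟨ R , nat k ⟩ ∈ L → j ≡ k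

-- A structure is the set ⟨ dom , rel ⟩, where rel is the disjoint union of the
-- interpretations, i.e. R(v) holds iff ⟨ R , tuple v ⟩ ∈ rel.

record Structure : Set₁ where
  constructor structure
  field
    dom rel : 𝕍

open Structure public

code : Structure → 𝕍
code 𝒜 = ⟨ dom 𝒜 , rel 𝒜 ⟩

Holds : Structure → 𝕍 → ∀ {k} → (Fin k → 𝕍) → Set
Holds 𝒜 R v = ⟨ R , tuple v ⟩ ∈ rel 𝒜

-- The empty domain is allowed.
IsStructure : 𝕍 → Structure → Set₁
IsStructure L 𝒜 =
  ∀ e → e ∈ rel 𝒜 →
  Σ[ R ∈ 𝕍 ] Σ[ k ∈ ℕ ] Σ[ v ∈ (Fin k → 𝕍) ]
    (⟨ R , nat k ⟩ ∈ L × (∀ i → v i ∈ dom 𝒜) × e ≈ ⟨ R , tuple v ⟩)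

record Substructure (L : 𝕍) (𝒜 ℬ : Structure) : Set₁ where
  field
    isStructure : IsStructure L 𝒜
    dom⊆        : dom 𝒜 ⊆ dom ℬ
    induced     : ∀ R k → ⟨ R , nat k ⟩ ∈ L → (v : Fin k → 𝕍) →
                  (∀ i → v i ∈ dom 𝒜) → (Holds 𝒜 R v ⇔ Holds ℬ R v)

record Embedding (L : 𝕍) (𝒜 ℬ : Structure) (f : 𝕍) : Set₁ where
  field
    isFunction : IsFunction f (dom 𝒜) (dom ℬ)
    injective  : ∀ x y z → ⟨ x , z ⟩ ∈ f → ⟨ y , z ⟩ ∈ f → x ≈ y
    preserves  : ∀ R k → ⟨ R , nat k ⟩ ∈ L → (v w : Fin k → 𝕍) →
                 (∀ i → ⟨ v i , w i ⟩ ∈ f) → (Holds 𝒜 R v ⇔ Holds ℬ R w)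

Isomorphism : 𝕍 → Structure → Structure → 𝕍 → Set₁
Isomorphism L 𝒜 ℬ f =
  Embedding L 𝒜 ℬ f × (∀ y → y ∈ dom ℬ → ∃[ x ] ⟨ x , y ⟩ ∈ f)

-- (g after f) x = z
_then_∶_↦_ : 𝕍 → 𝕍 → 𝕍 → 𝕍 → Set₁
f then g ∶ x ↦ z = ∃[ y ] (⟨ x , y ⟩ ∈ f × ⟨ y , z ⟩ ∈ g)

_∈Im_ : 𝕍 → 𝕍 → Set₁
z ∈Im f = ∃[ x ] ⟨ x , z ⟩ ∈ f

-- The quantifiers over structures and embeddings are relativised to V.
-- Closure under isomorphism is part of the definition of such a class.

record StrongFraïssé (V : Class) (L : 𝕍) (K : Class) : Set₁ where
  field
    finiteStructures :
      ∀ a → K a → ∃[ 𝒜 ] (a ≈ code 𝒜 × IsStructure L 𝒜 × Finite (dom 𝒜))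
    isoClosed :
      ∀ 𝒜 ℬ f → K (code 𝒜) → V (code ℬ) → IsStructure L ℬ →
      V f → Isomorphism L 𝒜 ℬ f → K (code ℬ)
    HP :
      ∀ 𝒜 ℬ → K (code ℬ) → V (code 𝒜) → Substructure L 𝒜 ℬ → K (code 𝒜)
    JEP :
      ∀ 𝒜 ℬ → K (code 𝒜) → K (code ℬ) →
      ∃[ 𝒞 ] (K (code 𝒞) × (∃[ f ] (V f × Embedding L 𝒜 𝒞 f))
                         × (∃[ g ] (V g × Embedding L ℬ 𝒞 g)))
    SAP :
      ∀ ℳ₀ ℳ₁ ℳ₂ i₁ i₂ →
      K (code ℳ₀) → K (code ℳ₁) → K (code ℳ₂) →
      V i₁ → Embedding L ℳ₀ ℳ₁ i₁ → V i₂ → Embedding L ℳ₀ ℳ₂ i₂ →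
      ∃[ ℳ₃ ] ∃[ j₁ ] ∃[ j₂ ]
        (K (code ℳ₃)
        × V j₁ × Embedding L ℳ₁ ℳ₃ j₁
        × V j₂ × Embedding L ℳ₂ ℳ₃ j₂
        × (∀ x z → (i₁ then j₁ ∶ x ↦ z) ⇔ (i₂ then j₂ ∶ x ↦ z))
        × (∀ z → (z ∈Im j₁ × z ∈Im j₂) ⇔ (∃[ x ] (i₁ then j₁ ∶ x ↦ z))))

-- Literals with variables among x₀, …, xₙ₋₁.

data Atomic (L : 𝕍) (n : ℕ) : Set₁ where
  relA : ∀ R k → ⟨ R , nat k ⟩ ∈ L → (Fin k → Fin n) → Atomic L n
  eqA  : Fin n → Fin n → Atomic L n

data Literal (L : 𝕍) (n : ℕ) : Set₁ where
  atom : Atomic L n → Literal L n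
  neg  : Literal L n → Literal L n

OccursA : ∀ {L n} → Fin n → Atomic L n → Set
OccursA i (relA R k _ x) = ∃[ j ] x j ≡ i
OccursA i (eqA j k)      = (j ≡ i) ⊎ (k ≡ i)

Occurs : ∀ {L n} → Fin n → Literal L n → Set
Occurs i (atom α) = OccursA i α
Occurs i (neg ψ)  = Occurs i ψ

-- The variables x₀, …, xₙ₋₁ are exactly the free variables of ψ.
HasArity : ∀ {L} n → Literal L n → Set
HasArity n ψ = ∀ i → Occurs i ψ

TrueA : ∀ {L n} → Structure → Atomic L n → (Fin n → 𝕍) → Set
TrueA 𝒜 (relA R k _ x) a = Holds 𝒜 R (a ∘ x)
TrueA 𝒜 (eqA i j)      a = a i ≈ a j

True : ∀ {L n} → Structure → Literal L n → (Fin n → 𝕍) → Set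
True 𝒜 (atom α) a = TrueA 𝒜 α a
True 𝒜 (neg ψ)  a = ¬ True 𝒜 ψ a

HoldsOnDistinct : ∀ {L n} → Class → Literal L n → Set₁
HoldsOnDistinct {n = n} K ψ =
  ∀ 𝒜 → K (code 𝒜) → (a : Fin n → 𝕍) → (∀ i → a i ∈ dom 𝒜) →
  (∀ i j → a i ≈ a j → i ≡ j) → True 𝒜 ψ a

Trivial : 𝕍 → Class → Set₁
Trivial L K =
  ∀ n (ψ : Literal L n) → HasArity n ψ →
  HoldsOnDistinct K ψ ⊎ HoldsOnDistinct K (neg ψ)

record Forcing : Set₂ where
  field
    Cond : 𝕍 → Set₁
    _≤_  : 𝕍 → 𝕍 → Set₁

ℭ : 𝕍 → Class → 𝕍 → Forcing
ℭ L K X = record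
  { Cond = λ p → K p × (∃[ 𝒜 ] (p ≈ code 𝒜 × dom 𝒜 ⊆ X))
  ; _≤_  = λ p q → ∃[ 𝒜 ] ∃[ ℬ ]
             (p ≈ code 𝒜 × q ≈ code ℬ × Substructure L ℬ 𝒜)
  }

Cohen : 𝕍 → Forcing
Cohen X = record
  { Cond = λ p →
      Finite p
      × (∀ e → e ∈ p → ∃[ x ] (x ∈ X × (e ≈ ⟨ x , nat 0 ⟩ ⊎ e ≈ ⟨ x , nat 1 ⟩)))
      × (∀ x y z → ⟨ x , y ⟩ ∈ p → ⟨ x , z ⟩ ∈ p → y ≈ z)
  ; _≤_  = λ p q → q ⊆ p
  }

Dense : Forcing → 𝕍 → Set₁
Dense ℙ D = (∀ p → p ∈ D → Cond p) × (∀ p → Cond p → ∃[ d ] (d ∈ D × d ≤ p))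
  where open Forcing ℙ

record Generic (V : Class) (ℙ : Forcing) (G : 𝕍) : Set₁ where
  open Forcing ℙ
  field
    conditions : ∀ p → p ∈ G → Cond p
    nonempty   : ∃[ p ] p ∈ G
    upward     : ∀ p q → p ∈ G → Cond q → p ≤ q → q ∈ G
    directed   : ∀ p q → p ∈ G → q ∈ G → ∃[ r ] (r ∈ G × r ≤ p × r ≤ q)
    meets      : ∀ D → V D → Dense ℙ D → ∃[ p ] (p ∈ G × p ∈ D)

data IsName (ℙ : Forcing) (τ : 𝕍) : Set₁ where
  name : (∀ e → e ∈ τ →
            ∃[ σ ] ∃[ p ] (e ≈ ⟨ σ , p ⟩ × Forcing.Cond ℙ p × IsName ℙ σ)) →
         IsName ℙ τ

Index : 𝕍 → Set
Index (sup A f) = A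

elem : (x : 𝕍) → Index x → 𝕍
elem (sup A f) = f

Index₂ : 𝕍 → Set
Index₂ x = Σ[ a ∈ Index x ] Index (elem x a)

elem₂ : (x : 𝕍) → Index₂ x → 𝕍
elem₂ x (a , b) = elem (elem x a) b

-- val G τ = { val G σ : ⟨ σ , p ⟩ ∈ τ for some p ∈ G }.  Since σ ∈ {σ} ∈ ⟨ σ , p ⟩,
-- the name σ is sought among the elements of elements of f a, which makes the
-- recursion structural.
mutual
  val : 𝕍 → 𝕍 → 𝕍
  val G (sup A f) =
    sup (Σ[ a ∈ A ] Σ[ u ∈ Index₂ (f a) ] Σ[ g ∈ Index G ]
           f a ≈ ⟨ elem₂ (f a) u , elem G g ⟩)
        (λ { (a , u , _) → val₂ G (f a) u })

  -- val₂ G x u = val G (elem₂ x u)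
  val₂ : (G x : 𝕍) → Index₂ x → 𝕍
  val₂ G (sup A f) (a , b) = val₁ G (f a) b

  val₁ : (G x : 𝕍) → Index x → 𝕍
  val₁ G (sup A f) a = val G (f a)

-- The generic extension V[G].
_[_∣_] : Class → Forcing → 𝕍 → Class
(V [ ℙ ∣ G ]) x = ∃[ τ ] (V τ × IsName ℙ τ × x ≈ val G τ)

{-# OPTIONS --safe #-}

-- Since K is nontrivial, there is a least n for which some atomic formula
-- R(x₀, …, xₙ₋₁), possibly with repeated variables, is true on some and false on
-- some n-tuples of distinct elements; JEP gives n = m + 1.  By minimality, any
-- bijection between sets of at most m elements of members of K is a partial
-- isomorphism.  Fix distinct c₁, …, cₘ in X and, for a condition 𝒜 containing all
-- of them, let h(𝒜) : dom 𝒜 → 2 tell whether R(x, c₁, …, cₘ) holds at x.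
-- If x ∉ dom 𝒜, strong amalgamation over {c₁, …, cₘ} extends 𝒜 by x with either
-- truth value of R(x, c₁, …, cₘ).  Hence every extension of h(𝒜) in ℂ[X] is
-- contained in h(ℬ) for some ℬ stronger than 𝒜, and the set H of all q ⊆ h(𝒜) with
-- 𝒜 ∈ G is generic.  The points cᵢ need no special treatment: their values are
-- settled as soon as they lie in dom 𝒜.
module Submission where

open import Level using (0ℓ; lift; lower) renaming (suc to lsuc)
open import Axiom.ExcludedMiddle using (ExcludedMiddle)
open import Data.Bool using (Bool; true; false)
open import Data.Empty using (⊥-elim)
open import Data.Fin using (Fin; zero; suc; toℕ; #_)
open import Data.Fin.Patterns
import Data.Fin.Properties as Fin
open import Data.Maybe using (Maybe; maybe′; just; nothing)
open import Data.Nat using (ℕ; zero; suc; _<_; _≤_; z≤n; s≤s)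
open import Data.Nat.Induction using (<-rec)
open import Data.Nat.Properties using (≤-refl)
open import Data.Product using (Σ-syntax; ∃-syntax; _×_; _,_; proj₁; proj₂)
open import Data.Sum using (_⊎_; inj₁; inj₂; [_,_]′)
open import Data.Vec using (Vec; []; _∷_; lookup)
open import Data.Vec.Functional using () renaming (_∷_ to _◂_)
open import Data.Vec.Relation.Unary.All using (All; []; _∷_)
open import Function using (_∘_; id)
open import Function.Bundles using (_⇔_; mk⇔; module Equivalence)
open import Function.Construct.Composition using (_⇔-∘_)
open import Function.Construct.Symmetry using (⇔-sym)
open import Relation.Binary.PropositionalEquality using (_≡_; refl; sym; subst; cong)
open import Relation.Nullary using (¬_; yes; no)
open import Defs

open Equivalence using (to; from)

-- Sets and pairs

-- The combinatorics above is carried out on ambient objects. The obstacle is membership of H in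
-- V[G]: H needs a name in V, so the relation "`q` is contained in h(𝒜)" must be a set of V.
-- Separation and replacement in V accept only syntactic formulas, while arities and numbers of
-- points are external natural numbers. Each formula is therefore chosen uniformly in these numbers,
-- and the finite data (a finite map, the points cᵢ, the shape of the atom) enter as set parameters,
-- which lie in V because every externally finite set of elements of V does. The name consists of
-- the pairs of a check name of `q` and a code of 𝒜, for `q` contained in h(𝒜). Check names are
-- defined by recursion, and no recursion theorem is proved inside V: the recursion runs along the
-- ambient well-founded type, and only its single step is performed in V by means of a definable
-- least solution.

≈-refl : ∀ x → x ≈ x
≈-refl (sup A f) = (λ a → a , ≈-refl (f a)) , (λ a → a , ≈-refl (f a))

≈-sym : ∀ x y → x ≈ y → y ≈ x
≈-sym (sup A f) (sup B g) (p , q) =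
  (λ b → let a , e = q b in a , ≈-sym (f a) (g b) e) ,
  (λ a → let b , e = p a in b , ≈-sym (f a) (g b) e)

≈-trans : ∀ x y z → x ≈ y → y ≈ z → x ≈ z
≈-trans (sup A f) (sup B g) (sup C h) (p , q) (p′ , q′) =
  (λ a → let b , e = p a ; c , e′ = p′ b in c , ≈-trans (f a) (g b) (h c) e e′) ,
  (λ c → let b , e′ = q′ c ; a , e = q b in a , ≈-trans (f a) (g b) (h c) e e′)

infix 4 _≋_ _ϵ_

-- Since _≈_ and _∈_ compute, their arguments cannot be inferred; the record
-- wrappers restore inference, and placing them in Set₁ brings them within the
-- reach of excluded middle.
record _≋_ (x y : 𝕍) : Set₁ where
  constructor eq
  field un≋ : x ≈ y

record _ϵ_ (x y : 𝕍) : Set₁ where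
  constructor el
  field unϵ : x ∈ y

open _≋_
open _ϵ_

≋-refl : ∀ {x} → x ≋ x
≋-refl {x} = eq (≈-refl x)

≋-sym : ∀ {x y} → x ≋ y → y ≋ x
≋-sym {x} {y} (eq p) = eq (≈-sym x y p)

≋-trans : ∀ {x y z} → x ≋ y → y ≋ z → x ≋ z
≋-trans {x} {y} {z} (eq p) (eq q) = eq (≈-trans x y z p q)

elemϵ : ∀ {x} (i : Index x) → elem x i ϵ x
elemϵ {sup A f} i = el (i , ≈-refl (f i))

index : ∀ {x y} → x ϵ y → Σ[ i ∈ Index y ] x ≋ elem y i
index {y = sup A f} (el (a , p)) = a , eq p

memb : ∀ {y} (i : Index y) {x} → x ≋ elem y i → x ϵ y
memb {sup A f} i (eq p) = el (i , p)

ϵ-respˡ : ∀ {x y z} → x ≋ y → x ϵ z → y ϵ z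
ϵ-respˡ e m = let i , p = index m in memb i (≋-trans (≋-sym e) p)

ϵ-respʳ : ∀ {x y z} → y ≋ z → x ϵ y → x ϵ z
ϵ-respʳ {y = sup A f} {z = sup B g} (eq (p , _)) (el (a , e)) =
  let b , e′ = p a in memb b (≋-trans (eq e) (eq e′))

≋-ext : ∀ {x y} → (∀ {z} → z ϵ x → z ϵ y) → (∀ {z} → z ϵ y → z ϵ x) → x ≋ y
≋-ext {sup A f} {sup B g} p q = eq
  ( (λ a → unϵ (p (elemϵ {sup A f} a)))
  , (λ b → let a , e = unϵ (q (elemϵ {sup B g} b)) in a , ≈-sym (g b) (f a) e) )

∉∅ : ∀ {x} → ¬ x ϵ ∅
∉∅ (el (() , _))

｛｝-introˡ : ∀ {x y z} → z ≋ x → z ϵ ｛ x , y ｝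
｛｝-introˡ (eq p) = el (true , p)

｛｝-introʳ : ∀ {x y z} → z ≋ y → z ϵ ｛ x , y ｝
｛｝-introʳ (eq p) = el (false , p)

｛｝-elim : ∀ {x y z} → z ϵ ｛ x , y ｝ → z ≋ x ⊎ z ≋ y
｛｝-elim (el (true , p))  = inj₁ (eq p)
｛｝-elim (el (false , p)) = inj₂ (eq p)

｛｝-cong : ∀ {x y x′ y′} → x ≋ x′ → y ≋ y′ → ｛ x , y ｝ ≋ ｛ x′ , y′ ｝
｛｝-cong (eq p) (eq q) = eq
  ( (λ { true → true , p ; false → false , q })
  , (λ { true → true , p ; false → false , q }) )

⟨⟩-cong : ∀ {x y x′ y′} → x ≋ x′ → y ≋ y′ → ⟨ x , y ⟩ ≋ ⟨ x′ , y′ ⟩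
⟨⟩-cong p q = ｛｝-cong (｛｝-cong p p) (｛｝-cong p q)

⟨⟩-injˡ : ∀ {x y x′ y′} → ⟨ x , y ⟩ ≋ ⟨ x′ , y′ ⟩ → x ≋ x′
⟨⟩-injˡ e with ｛｝-elim (ϵ-respʳ (≋-sym e) (｛｝-introˡ ≋-refl))
... | inj₁ s = [ ≋-sym , ≋-sym ]′ (｛｝-elim (ϵ-respʳ s (｛｝-introˡ ≋-refl)))
... | inj₂ s with ｛｝-elim (ϵ-respʳ (≋-sym s) (｛｝-introˡ ≋-refl))
...   | inj₁ p = p
...   | inj₂ p = p

⟨⟩-injʳ : ∀ {x y x′ y′} → ⟨ x , y ⟩ ≋ ⟨ x′ , y′ ⟩ → y ≋ y′
⟨⟩-injʳ {x} {y} {x′} {y′} e with ｛｝-elim (ϵ-respʳ e (｛｝-introʳ ≋-refl))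
... | inj₁ s = ≋-sym (y′≋y (｛｝-elim (ϵ-respʳ (≋-sym e) (｛｝-introʳ ≋-refl))))
  where
  y≋x′ : y ≋ x′
  y≋x′ = [ (λ p → p) , (λ p → p) ]′ (｛｝-elim (ϵ-respʳ s (｛｝-introʳ ≋-refl)))
  x≋y : x ≋ y
  x≋y = ≋-trans (⟨⟩-injˡ e) (≋-sym y≋x′)
  y′≋y : ｛ x′ , y′ ｝ ≋ ｛ x , x ｝ ⊎ ｛ x′ , y′ ｝ ≋ ｛ x , y ｝ → y′ ≋ y
  y′≋y (inj₁ t) = ≋-trans
    ([ (λ p → p) , (λ p → p) ]′ (｛｝-elim (ϵ-respʳ t (｛｝-introʳ ≋-refl)))) x≋y
  y′≋y (inj₂ t) =
    [ (λ p → ≋-trans p x≋y) , (λ p → p) ]′ (｛｝-elim (ϵ-respʳ t (｛｝-introʳ ≋-refl)))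
... | inj₂ s with ｛｝-elim (ϵ-respʳ s (｛｝-introʳ ≋-refl))
...   | inj₂ p = p
...   | inj₁ p with ｛｝-elim (ϵ-respʳ (≋-sym s) (｛｝-introʳ ≋-refl))
...     | inj₁ q = ≋-trans p (≋-trans (≋-sym (⟨⟩-injˡ e)) (≋-sym q))
...     | inj₂ q = ≋-sym q

tuple-cong : ∀ {k} {v w : Fin k → 𝕍} → (∀ i → v i ≋ w i) → tuple v ≋ tuple w
tuple-cong {v = v} {w} e = eq
  ( (λ i → i , un≋ (⟨⟩-cong {nat (toℕ i)} ≋-refl (e i)))
  , (λ i → i , un≋ (⟨⟩-cong {nat (toℕ i)} ≋-refl (e i))) )

infixl 6 _∪_
_∪_ : 𝕍 → 𝕍 → 𝕍
sup A f ∪ sup B g = sup (A ⊎ B) [ f , g ]′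

∪-introˡ : ∀ {x y z} → z ϵ x → z ϵ x ∪ y
∪-introˡ {sup A f} {sup B g} (el (a , p)) = el (inj₁ a , p)

∪-introʳ : ∀ {x y z} → z ϵ y → z ϵ x ∪ y
∪-introʳ {sup A f} {sup B g} (el (b , p)) = el (inj₂ b , p)

∪-elim : ∀ {x y z} → z ϵ x ∪ y → z ϵ x ⊎ z ϵ y
∪-elim {sup A f} {sup B g} (el (inj₁ a , p)) = inj₁ (el (a , p))
∪-elim {sup A f} {sup B g} (el (inj₂ b , p)) = inj₂ (el (b , p))

S-elim : ∀ {x z} → z ϵ S x → z ϵ x ⊎ z ≋ x
S-elim {sup A f} (el (just a , p))  = inj₁ (el (a , p))
S-elim {sup A f} (el (nothing , p)) = inj₂ (eq p)

S-introˡ : ∀ {x z} → z ϵ x → z ϵ S x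
S-introˡ {sup A f} (el (a , p)) = el (just a , p)

S-introʳ : ∀ {x z} → z ≋ x → z ϵ S x
S-introʳ {sup A f} (eq p) = el (nothing , p)

-- Closure properties of a transitive model and definable subsets.

module Model {V : Class} (M : IsTransitiveModel V) where

  open IsTransitiveModel M
  open ZFC zfc

  V-resp : ∀ {x y} → x ≋ y → V x → V y
  V-resp {x} {y} (eq e) = respects x y e

  V-elem : ∀ {x y} → V x → y ϵ x → V y
  V-elem {x} {y} vx (el m) = transitive x y vx m

  V-｛｝ : ∀ {x y} → V x → V y → V ｛ x , y ｝
  V-｛｝ {x} {y} vx vy with pairing x y vx vy
  ... | p , vp , h = V-resp (≋-ext
    (λ {z} m → [ (λ e → ｛｝-introˡ (eq e)) , (λ e → ｛｝-introʳ (eq e)) ]′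
                 (to (h z (V-elem vp m)) (unϵ m)))
    (λ {z} m → [ (λ e → el (from (h z (V-resp (≋-sym e) vx)) (inj₁ (un≋ e))))
               , (λ e → el (from (h z (V-resp (≋-sym e) vy)) (inj₂ (un≋ e)))) ]′
                 (｛｝-elim m))) vp

  V-⟨⟩ : ∀ {x y} → V x → V y → V ⟨ x , y ⟩
  V-⟨⟩ vx vy = V-｛｝ (V-｛｝ vx vx) (V-｛｝ vx vy)

  V-fst : ∀ {x y} → V ⟨ x , y ⟩ → V x
  V-fst v = V-elem (V-elem v (｛｝-introˡ ≋-refl)) (｛｝-introˡ ≋-refl)

  V-snd : ∀ {x y} → V ⟨ x , y ⟩ → V y
  V-snd v = V-elem (V-elem v (｛｝-introʳ ≋-refl)) (｛｝-introʳ ≋-refl)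

  abstract
    ⋃-exists : ∀ {x} → V x → ∃[ u ] (V u
      × (∀ {z} → z ϵ u → ∃[ y ] (y ϵ x × z ϵ y)) × (∀ {y z} → y ϵ x → z ϵ y → z ϵ u))
    ⋃-exists {x} vx with union x vx
    ... | u , vu , h = u , vu
      , (λ {z} m → let y , _ , p , q = to (h z (V-elem vu m)) (unϵ m) in y , el p , el q)
      , (λ {y} {z} p q → el (from (h z (V-elem (V-elem vx p) q))
                              (y , V-elem vx p , unϵ p , unϵ q)))

  abstract
    V-∪ : ∀ {x y} → V x → V y → V (x ∪ y)
    V-∪ {x} {y} vx vy with ⋃-exists (V-｛｝ vx vy)
    ... | u , vu , p , q = V-resp (≋-ext
      (λ m → let w , a , b = p m in
         [ (λ e → ∪-introˡ (ϵ-respʳ e b)) , (λ e → ∪-introʳ {x} (ϵ-respʳ e b)) ]′ (｛｝-elim a))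
      (λ m → [ q (｛｝-introˡ ≋-refl) , q (｛｝-introʳ ≋-refl) ]′ (∪-elim m))) vu

  abstract
    power-bound : ∀ {x} → V x →
      ∃[ p ] (V p × (∀ {y} → V y → (∀ {z} → z ϵ y → z ϵ x) → y ϵ p))
    power-bound {x} vx with powerset x vx
    ... | p , vp , h = p , vp , λ {y} vy s →
      el (from (h y vy) (λ z _ m → unϵ (s (el m))))

  V-∅ : V ∅
  V-∅ with infinity
  ... | _ , _ , (e , ve , _ , h) , _ =
    V-resp (≋-ext (λ {z} m → ⊥-elim (h z (V-elem ve m) (unϵ m))) (λ m → ⊥-elim (∉∅ m))) ve

  abstract
    -- A superset of ω is enough: like the other `-bound` lemmas, this one only supplies a set from
    -- which to separate.
    ω-bound : ∃[ w ] (V w × (∀ n → nat n ϵ w))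
    ω-bound with infinity
    ... | w , vw , (e , ve , e∈w , he) , hs = w , vw , go
      where
      go : ∀ n → nat n ϵ w
      go zero = ϵ-respˡ
        (≋-ext (λ {z} m → ⊥-elim (he z (V-elem ve m) (unϵ m))) (λ m → ⊥-elim (∉∅ m))) (el e∈w)
      go (suc n) with hs (nat n) (V-elem vw (go n)) (unϵ (go n))
      ... | y , vy , y∈w , h = ϵ-respˡ (≋-ext
        (λ {z} m → [ (λ p → S-introˡ (el p)) , (λ p → S-introʳ (eq p)) ]′
                     (to (h z (V-elem vy m)) (unϵ m)))
        (λ {z} m → [ (λ p → el (from (h z (V-elem (V-elem vw (go n)) p)) (inj₁ (unϵ p))))
                   , (λ p → el (from (h z (V-resp (≋-sym p) (V-elem vw (go n)))) (inj₂ (un≋ p)))) ]′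
                     (S-elim m))) (el y∈w)

  V-nat : ∀ n → V (nat n)
  V-nat n = let w , vw , h = ω-bound in V-elem vw (h n)

  -- By induction on the external number `n`, so the enumeration `v` itself need not be definable in
  -- V.
  V-finite : ∀ {n} (v : Fin n → 𝕍) → (∀ i → V (v i)) → V (sup (Fin n) v)
  V-finite {zero} v h = V-resp (≋-ext (λ m → ⊥-elim (∉∅ m)) λ { (el (() , _)) }) V-∅
  V-finite {suc n} v h = V-resp (≋-ext
      (λ m → [ (λ a → [ (λ e → memb zero e) , (λ e → memb zero e) ]′ (｛｝-elim a))
             , (λ { (el (i , p)) → el (suc i , p) }) ]′ (∪-elim m))
      (λ { (el (zero , p))  → ∪-introˡ (｛｝-introˡ (eq p))
         ; (el (suc i , p)) → ∪-introʳ {｛ v zero , v zero ｝} (el (i , p)) }))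
    (V-∪ (V-｛｝ (h zero) (h zero)) (V-finite (v ∘ suc) (h ∘ suc)))

  V-tuple : ∀ {k} (v : Fin k → 𝕍) → (∀ i → V (v i)) → V (tuple v)
  V-tuple v h = V-finite _ (λ i → V-⟨⟩ (V-nat (toℕ i)) (h i))

  abstract
    -- A Kuratowski pair of elements of x ∪ y is a set of subsets of x ∪ y, so the double power set
    -- contains it.
    product-bound : ∀ {x y} → V x → V y →
      ∃[ p ] (V p × (∀ {a b} → a ϵ x → b ϵ y → ⟨ a , b ⟩ ϵ p))
    product-bound {x} {y} vx vy with power-bound (V-∪ vx vy)
    ... | P , vP , hP with power-bound vP
    ...   | Q , vQ , hQ = Q , vQ , λ {a} {b} ma mb →
      let va = V-elem vx ma ; vb = V-elem vy mb
          ia = ∪-introˡ {x} {y} ma ; ib = ∪-introʳ {x} {y} mb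
          sub : ∀ {s t} → s ϵ x ∪ y → t ϵ x ∪ y → ∀ {z} → z ϵ ｛ s , t ｝ → z ϵ x ∪ y
          sub ms mt m = [ (λ e → ϵ-respˡ (≋-sym e) ms) , (λ e → ϵ-respˡ (≋-sym e) mt) ]′ (｛｝-elim m)
      in hQ (V-⟨⟩ va vb) λ m →
        [ (λ e → ϵ-respˡ (≋-sym e) (hP (V-｛｝ va va) (sub ia ia)))
        , (λ e → ϵ-respˡ (≋-sym e) (hP (V-｛｝ va vb) (sub ia ib))) ]′ (｛｝-elim m)

  Sat-cong : ∀ {n} (φ : Formula n) {ρ σ : Vec 𝕍 n} →
    (∀ i → lookup ρ i ≋ lookup σ i) → Sat V φ ρ → Sat V φ σ
  Sat-cong (i ∈′ j) e (lift h) = lift (unϵ (ϵ-respˡ (e i) (ϵ-respʳ (e j) (el h))))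
  Sat-cong (i ≈′ j) e (lift h) = lift (un≋ (≋-trans (≋-sym (e i)) (≋-trans (eq h) (e j))))
  Sat-cong ⊥′       e (lift h) = lift h
  Sat-cong (φ ∧′ ψ) e (h , k)  = Sat-cong φ e h , Sat-cong ψ e k
  Sat-cong (φ ∨′ ψ) e (inj₁ h) = inj₁ (Sat-cong φ e h)
  Sat-cong (φ ∨′ ψ) e (inj₂ h) = inj₂ (Sat-cong ψ e h)
  Sat-cong (φ ⇒′ ψ) e h k = Sat-cong ψ e (h (Sat-cong φ (λ i → ≋-sym (e i)) k))
  Sat-cong (∀′ φ)   e h x vx =
    Sat-cong φ (λ { zero → ≋-refl ; (suc i) → e i }) (h x vx)
  Sat-cong (∃′ φ)   e (x , vx , h) =
    x , vx , Sat-cong φ (λ { zero → ≋-refl ; (suc i) → e i }) h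

  -- Formulas with bounded quantifiers and ordered pairs, whose semantics ⟦_⟧ is
  -- absolute except for the quantifiers ∀V and ∃V.  ∃⟨⟩ i φ reads "xᵢ = ⟨ y , z ⟩
  -- and φ for some y and z", with z as index 0 and y as index 1 in φ.
  data Fm (n : ℕ) : Set where
    _∈ᶠ_ _≈ᶠ_      : Fin n → Fin n → Fm n
    ⟪_,_⟫∈ᶠ_       : Fin n → Fin n → Fin n → Fm n
    ¬ᶠ_            : Fm n → Fm n
    _∧ᶠ_ _∨ᶠ_ _⇒ᶠ_ : Fm n → Fm n → Fm n
    ∀∈ ∃∈          : Fin n → Fm (suc n) → Fm n
    ∃⟨⟩            : Fin n → Fm (suc (suc n)) → Fm n
    ∀V ∃V          : Fm (suc n) → Fm n

  infix  8 _∈ᶠ_ _≈ᶠ_ ⟪_,_⟫∈ᶠ_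
  infix  7 ¬ᶠ_
  infixr 6 _∧ᶠ_
  infixr 5 _∨ᶠ_
  infixr 4 _⇒ᶠ_

  ⟦_⟧ : ∀ {n} → Fm n → Vec 𝕍 n → Set₁
  ⟦ i ∈ᶠ j ⟧ ρ         = lookup ρ i ϵ lookup ρ j
  ⟦ i ≈ᶠ j ⟧ ρ         = lookup ρ i ≋ lookup ρ j
  ⟦ ⟪ i , j ⟫∈ᶠ k ⟧ ρ = ⟨ lookup ρ i , lookup ρ j ⟩ ϵ lookup ρ k
  ⟦ ¬ᶠ φ ⟧ ρ           = ¬ ⟦ φ ⟧ ρ
  ⟦ φ ∧ᶠ ψ ⟧ ρ         = ⟦ φ ⟧ ρ × ⟦ ψ ⟧ ρ
  ⟦ φ ∨ᶠ ψ ⟧ ρ         = ⟦ φ ⟧ ρ ⊎ ⟦ ψ ⟧ ρ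
  ⟦ φ ⇒ᶠ ψ ⟧ ρ         = ⟦ φ ⟧ ρ → ⟦ ψ ⟧ ρ
  ⟦ ∀∈ i φ ⟧ ρ         = ∀ x → x ϵ lookup ρ i → ⟦ φ ⟧ (x ∷ ρ)
  ⟦ ∃∈ i φ ⟧ ρ         = ∃[ x ] (x ϵ lookup ρ i × ⟦ φ ⟧ (x ∷ ρ))
  ⟦ ∃⟨⟩ i φ ⟧ ρ        = ∃[ x ] ∃[ y ] (lookup ρ i ≋ ⟨ x , y ⟩ × ⟦ φ ⟧ (y ∷ x ∷ ρ))
  ⟦ ∀V φ ⟧ ρ           = ∀ x → V x → ⟦ φ ⟧ (x ∷ ρ)
  ⟦ ∃V φ ⟧ ρ           = ∃[ x ] (V x × ⟦ φ ⟧ (x ∷ ρ))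

  upair′ pair′ : ∀ {n} → Fin n → Fin n → Fin n → Formula n
  upair′ i j k =
    ∀′ ((zero ∈′ suc i) ⇒′ ((zero ≈′ suc j) ∨′ (zero ≈′ suc k))) ∧′ ((j ∈′ i) ∧′ (k ∈′ i))
  pair′ i j k = ∃′ (∃′
    (upair′ (suc zero) (suc (suc j)) (suc (suc j)) ∧′
    (upair′ zero (suc (suc j)) (suc (suc k)) ∧′
     upair′ (suc (suc i)) (suc zero) zero)))

  module _ {n} (ρ : Vec 𝕍 n) (i j k : Fin n) where
    private
      x = lookup ρ i
      y = lookup ρ j
      z = lookup ρ k

    upair-sound : V x → Sat V (upair′ i j k) ρ → x ≋ ｛ y , z ｝
    upair-sound vx (h , lift p , lift q) = ≋-ext
      (λ {u} m → [ (λ e → ｛｝-introˡ (eq (lower e))) , (λ e → ｛｝-introʳ (eq (lower e))) ]′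
                   (h u (V-elem vx m) (lift (unϵ m))))
      (λ m → [ (λ e → ϵ-respˡ (≋-sym e) (el p)) , (λ e → ϵ-respˡ (≋-sym e) (el q)) ]′ (｛｝-elim m))

    upair-complete : x ≋ ｛ y , z ｝ → Sat V (upair′ i j k) ρ
    upair-complete e =
      (λ u _ m → [ (λ p → inj₁ (lift (un≋ p))) , (λ p → inj₂ (lift (un≋ p))) ]′
                   (｛｝-elim (ϵ-respʳ e (el (lower m)))))
      , lift (unϵ (ϵ-respʳ (≋-sym e) (｛｝-introˡ ≋-refl)))
      , lift (unϵ (ϵ-respʳ (≋-sym e) (｛｝-introʳ ≋-refl)))

  module _ {n} (ρ : Vec 𝕍 n) (i j k : Fin n) where
    private
      x = lookup ρ i
      y = lookup ρ j
      z = lookup ρ k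

    pair-sound : V x → Sat V (pair′ i j k) ρ → x ≋ ⟨ y , z ⟩
    pair-sound vx (s , vs , t , vt , p , q , r) = ≋-trans
      (upair-sound (t ∷ s ∷ ρ) (suc (suc i)) (suc zero) zero vx r)
      (｛｝-cong (upair-sound (t ∷ s ∷ ρ) (suc zero) (suc (suc j)) (suc (suc j)) vs p)
                (upair-sound (t ∷ s ∷ ρ) zero (suc (suc j)) (suc (suc k)) vt q))

    pair-complete : V y → V z → x ≋ ⟨ y , z ⟩ → Sat V (pair′ i j k) ρ
    pair-complete vy vz e = ｛ y , y ｝ , V-｛｝ vy vy , ｛ y , z ｝ , V-｛｝ vy vz
      , upair-complete σ (suc zero) (suc (suc j)) (suc (suc j)) ≋-refl
      , upair-complete σ zero (suc (suc j)) (suc (suc k)) ≋-refl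
      , upair-complete σ (suc (suc i)) (suc zero) zero e
      where
      σ : Vec 𝕍 (suc (suc n))
      σ = ｛ y , z ｝ ∷ ｛ y , y ｝ ∷ ρ

  translate : ∀ {n} → Fm n → Formula n
  translate (i ∈ᶠ j)         = i ∈′ j
  translate (i ≈ᶠ j)         = i ≈′ j
  translate (⟪ i , j ⟫∈ᶠ k) = ∃′ (pair′ zero (suc i) (suc j) ∧′ (zero ∈′ suc k))
  translate (¬ᶠ φ)           = translate φ ⇒′ ⊥′
  translate (φ ∧ᶠ ψ)         = translate φ ∧′ translate ψ
  translate (φ ∨ᶠ ψ)         = translate φ ∨′ translate ψ
  translate (φ ⇒ᶠ ψ)         = translate φ ⇒′ translate ψ
  translate (∀∈ i φ)         = ∀′ ((zero ∈′ suc i) ⇒′ translate φ)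
  translate (∃∈ i φ)         = ∃′ ((zero ∈′ suc i) ∧′ translate φ)
  translate (∃⟨⟩ i φ)        = ∃′ (∃′ (pair′ (suc (suc i)) (suc zero) zero ∧′ translate φ))
  translate (∀V φ)           = ∀′ (translate φ)
  translate (∃V φ)           = ∃′ (translate φ)

  V-lookup : ∀ {n} {ρ : Vec 𝕍 n} → All V ρ → ∀ i → V (lookup ρ i)
  V-lookup (v ∷ vs) zero    = v
  V-lookup (v ∷ vs) (suc i) = V-lookup vs i

  -- Mutual with `complete`, since negation and implication exchange the two directions.
  -- Transitivity of V makes the bounded quantifiers and the components of pairs absolute.
  sound : ∀ {n} (φ : Fm n) {ρ} → All V ρ → Sat V (translate φ) ρ → ⟦ φ ⟧ ρ
  complete : ∀ {n} (φ : Fm n) {ρ} → All V ρ → ⟦ φ ⟧ ρ → Sat V (translate φ) ρ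

  sound (i ∈ᶠ j) vs (lift h) = el h
  sound (i ≈ᶠ j) vs (lift h) = eq h
  sound (⟪ i , j ⟫∈ᶠ k) {ρ} vs (x , vx , p , lift m) =
    ϵ-respˡ (pair-sound (x ∷ ρ) zero (suc i) (suc j) vx p) (el m)
  sound (¬ᶠ φ) vs h k = lower (h (complete φ vs k))
  sound (φ ∧ᶠ ψ) vs (h , k) = sound φ vs h , sound ψ vs k
  sound (φ ∨ᶠ ψ) vs (inj₁ h) = inj₁ (sound φ vs h)
  sound (φ ∨ᶠ ψ) vs (inj₂ h) = inj₂ (sound ψ vs h)
  sound (φ ⇒ᶠ ψ) vs h k = sound ψ vs (h (complete φ vs k))
  sound (∀∈ i φ) vs h x m =
    let vx = V-elem (V-lookup vs i) m in sound φ (vx ∷ vs) (h x vx (lift (unϵ m)))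
  sound (∃∈ i φ) vs (x , vx , lift m , h) = x , el m , sound φ (vx ∷ vs) h
  sound (∃⟨⟩ i φ) {ρ} vs (x , vx , y , vy , p , h) =
    x , y , pair-sound (y ∷ x ∷ ρ) (suc (suc i)) (suc zero) zero (V-lookup vs i) p
    , sound φ (vy ∷ vx ∷ vs) h
  sound (∀V φ) vs h x vx = sound φ (vx ∷ vs) (h x vx)
  sound (∃V φ) vs (x , vx , h) = x , vx , sound φ (vx ∷ vs) h

  complete (i ∈ᶠ j) vs h = lift (unϵ h)
  complete (i ≈ᶠ j) vs h = lift (un≋ h)
  complete (⟪ i , j ⟫∈ᶠ k) {ρ} vs h =
    ⟨ lookup ρ i , lookup ρ j ⟩ , V-⟨⟩ (V-lookup vs i) (V-lookup vs j)
    , pair-complete (_ ∷ ρ) zero (suc i) (suc j) (V-lookup vs i) (V-lookup vs j) ≋-refl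
    , lift (unϵ h)
  complete (¬ᶠ φ) vs h k = lift (h (sound φ vs k))
  complete (φ ∧ᶠ ψ) vs (h , k) = complete φ vs h , complete ψ vs k
  complete (φ ∨ᶠ ψ) vs (inj₁ h) = inj₁ (complete φ vs h)
  complete (φ ∨ᶠ ψ) vs (inj₂ h) = inj₂ (complete ψ vs h)
  complete (φ ⇒ᶠ ψ) vs h k = complete ψ vs (h (sound φ vs k))
  complete (∀∈ i φ) vs h x vx (lift m) = complete φ (vx ∷ vs) (h x (el m))
  complete (∃∈ i φ) vs (x , m , h) =
    let vx = V-elem (V-lookup vs i) m in x , vx , lift (unϵ m) , complete φ (vx ∷ vs) h
  complete (∃⟨⟩ i φ) {ρ} vs (x , y , e , h) =
    let vp = V-resp e (V-lookup vs i) ; vx = V-fst vp ; vy = V-snd vp in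
    x , vx , y , vy
    , pair-complete (y ∷ x ∷ ρ) (suc (suc i)) (suc zero) zero vx vy e
    , complete φ (vy ∷ vx ∷ vs) h
  complete (∀V φ) vs h x vx = complete φ (vx ∷ vs) (h x vx)
  complete (∃V φ) vs (x , vx , h) = x , vx , complete φ (vx ∷ vs) h

  abstract
    separate : ∀ {n} (φ : Fm (suc n)) {ρ} → All V ρ → ∀ {x} → V x →
      ∃[ y ] (V y × (∀ {z} → z ϵ y → z ϵ x × ⟦ φ ⟧ (z ∷ ρ))
                  × (∀ {z} → z ϵ x → ⟦ φ ⟧ (z ∷ ρ) → z ϵ y))
    separate φ {ρ} vs {x} vx with separation (translate φ) ρ vs x vx
    ... | y , vy , h = y , vy
      , (λ {z} m → let vz = V-elem vy m ; p , q = to (h z vz) (unϵ m) in el p , sound φ (vz ∷ vs) q)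
      , (λ {z} m p → let vz = V-elem vx m in el (from (h z vz) (unϵ m , complete φ (vz ∷ vs) p)))

    -- Replacement for values extracted from a membership proof: `F` may depend on that proof, as
    -- long as the formula pins the value down up to `≋`.
    image : ∀ {n} (φ : Fm (suc (suc n))) {ρ} → All V ρ → ∀ {x} → V x →
      (F : ∀ {y} → y ϵ x → 𝕍) →
      (∀ {y} (m : y ϵ x) → V (F m)) → (∀ {y} (m : y ϵ x) → ⟦ φ ⟧ (F m ∷ y ∷ ρ)) →
      (∀ {y z} (m : y ϵ x) → ⟦ φ ⟧ (z ∷ y ∷ ρ) → z ≋ F m) →
      ∃[ r ] (V r × (∀ {z} → z ϵ r → ∃[ y ] Σ[ m ∈ y ϵ x ] z ≋ F m)
                  × (∀ {y} (m : y ϵ x) → F m ϵ r))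
    image φ {ρ} vs {x} vx F vF hF uF =
      let r , vr , h = replacement (translate φ) ρ vs x vx λ y vy m →
            F (el m) , vF (el m) , complete φ (vF (el m) ∷ vy ∷ vs) (hF (el m))
            , λ z vz p → un≋ (uF (el m) (sound φ (vz ∷ vy ∷ vs) p))
      in r , vr
        , (λ {z} m → let vz = V-elem vr m ; y , vy , p , q = to (h z vz) (unϵ m) in
                     y , el p , uF (el p) (sound φ (vz ∷ vy ∷ vs) q))
        , λ {y} m → let vy = V-elem vx m in
            el (from (h (F m) (vF m)) (y , vy , unϵ m , complete φ (vF m ∷ vy ∷ vs) (hF m)))

-- Names

module Names (G : 𝕍) where

  Index₂-of : ∀ {x y z} → y ϵ x → z ϵ y → Σ[ u ∈ Index₂ x ] z ≋ elem₂ x u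
  Index₂-of m k =
    let i , p = index m ; j , q = index (ϵ-respʳ p k) in (i , j) , q

  fst-Index₂ : ∀ {x y z} → x ≋ ⟨ y , z ⟩ → Σ[ u ∈ Index₂ x ] y ≋ elem₂ x u
  fst-Index₂ e = Index₂-of (ϵ-respʳ (≋-sym e) (｛｝-introˡ ≋-refl)) (｛｝-introˡ ≋-refl)

  val₁≡ : ∀ x i → val₁ G x i ≡ val G (elem x i)
  val₁≡ (sup A f) a = refl

  val₂≡ : ∀ x u → val₂ G x u ≡ val G (elem₂ x u)
  val₂≡ (sup A f) (a , b) = val₁≡ (f a) b

  -- The split into three functions copies that of `val`, which keeps the recursion structural.
  -- Equal elements need not have equal indices, so the index of the name is looked up again on the
  -- other side.
  val-cong  : ∀ x y → x ≋ y → val G x ≋ val G y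
  val-cong₂ : ∀ x y u v → elem₂ x u ≋ elem₂ y v → val₂ G x u ≋ val₂ G y v
  val-cong₁ : ∀ x y i j → elem x i ≋ elem y j → val₁ G x i ≋ val₁ G y j

  val-cong (sup A f) (sup B g) (eq (p , q)) = eq
    ( (λ { (a , u , k , e) →
           let b , r = p a
               e′ = ≋-trans (≋-sym (eq r)) (eq e)
               v , s = fst-Index₂ e′
           in (b , v , k , un≋ (≋-trans e′ (⟨⟩-cong s ≋-refl)))
              , un≋ (val-cong₂ (f a) (g b) u v s) })
    , (λ { (b , v , k , e) →
           let a , r = q b
               e′ = ≋-trans (eq r) (eq e)
               u , s = fst-Index₂ e′
           in (a , u , k , un≋ (≋-trans e′ (⟨⟩-cong s ≋-refl)))
              , un≋ (val-cong₂ (f a) (g b) u v (≋-sym s)) }) )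
  val-cong₂ (sup A f) (sup B g) (a , i) (b , j) e = val-cong₁ (f a) (g b) i j e
  val-cong₁ (sup A f) (sup B g) a b e = val-cong (f a) (g b) e

  val-elim : ∀ {τ z} → z ϵ val G τ →
    ∃[ σ ] ∃[ p ] (⟨ σ , p ⟩ ϵ τ × p ϵ G × z ≋ val G σ)
  val-elim {sup A f} {z} (el ((a , u , k , e) , h)) =
    elem₂ (f a) u , elem G k , memb a (≋-sym (eq e)) , elemϵ k
    , subst (z ≋_) (val₂≡ (f a) u) (eq h)

  val-intro : ∀ {τ σ p} → ⟨ σ , p ⟩ ϵ τ → p ϵ G → val G σ ϵ val G τ
  val-intro {sup A f} {σ} (el (a , e)) m =
    let k , r = index m
        u , s = fst-Index₂ (≋-sym (eq e))
    in el ((a , u , k , un≋ (≋-trans (≋-sym (eq e)) (⟨⟩-cong s r)))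
          , un≋ (subst (val G σ ≋_) (sym (val₂≡ (f a) u)) (val-cong σ _ s)))

-- Check names and their existence in the model.

module Check (p₀ : 𝕍) where

  -- For p₀ in the generic filter, check x is a name of x.
  check : 𝕍 → 𝕍
  check (sup A f) = sup A λ a → ⟨ check (f a) , p₀ ⟩

  check-cong : ∀ {x y} → x ≋ y → check x ≋ check y
  check-cong {sup A f} {sup B g} (eq (p , q)) = eq
    ( (λ a → let b , e = p a in b , un≋ (⟨⟩-cong (check-cong (eq e)) ≋-refl))
    , (λ b → let a , e = q b in a , un≋ (⟨⟩-cong (check-cong (eq e)) ≋-refl)) )

  check-intro : ∀ {x y} → y ϵ x → ⟨ check y , p₀ ⟩ ϵ check x
  check-intro {sup A f} (el (a , e)) = memb a (⟨⟩-cong (check-cong (eq e)) ≋-refl)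

  check-elim : ∀ {x e} → e ϵ check x → ∃[ y ] (y ϵ x × e ≋ ⟨ check y , p₀ ⟩)
  check-elim {sup A f} (el (a , p)) = f a , elemϵ a , eq p

  check-name : ∀ {ℙ} → Forcing.Cond ℙ p₀ → ∀ x → IsName ℙ (check x)
  check-name c (sup A f) = name λ { e (a , p) →
    check (f a) , p₀ , p , c , check-name c (f a) }

  val-check : ∀ {G} → p₀ ϵ G → ∀ x → val G (check x) ≋ x
  val-check {G} m (sup A f) = ≋-ext
    (λ k → let σ , p , n , _ , r = val-elim k
               y , l , s = check-elim {sup A f} n
               a , t = index {y = sup A f} l
           in memb a (≋-trans r (≋-trans (val-cong _ _
                (≋-trans (⟨⟩-injˡ s) (check-cong t))) (val-check m (f a)))))
    (λ { (el (a , r)) → ϵ-respˡ (≋-trans (val-check m (f a)) (≋-sym (eq r)))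
           (val-intro {sup A _} (elemϵ a) m) })
    where open Names G

  -- { ⟨ y , check y ⟩ : y in the transitive closure of {x} }
  graph : 𝕍 → 𝕍
  graph (sup A f) = sup (Maybe (Σ[ a ∈ A ] Index (graph (f a))))
    (maybe′ (λ { (a , i) → elem (graph (f a)) i }) ⟨ sup A f , check (sup A f) ⟩)

  graph-self : ∀ {x} → ⟨ x , check x ⟩ ϵ graph x
  graph-self {sup A f} = elemϵ {graph (sup A f)} nothing

  graph-below : ∀ {A f} (a : A) {e} → e ϵ graph (f a) → e ϵ graph (sup A f)
  graph-below {A} {f} a m = let i , p = index m in memb {graph (sup A f)} (just (a , i)) p

  graph-elim : ∀ {A f e} → e ϵ graph (sup A f) →
    e ≋ ⟨ sup A f , check (sup A f) ⟩ ⊎ (Σ[ a ∈ A ] e ϵ graph (f a))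
  graph-elim (el (nothing , p))      = inj₁ (eq p)
  graph-elim (el (just (a , i) , p)) = inj₂ (a , memb i (eq p))

  graph-elim′ : ∀ {x e} → e ϵ graph x →
    e ≋ ⟨ x , check x ⟩ ⊎ (∃[ y ] (y ϵ x × e ϵ graph y))
  graph-elim′ {sup A f} m with graph-elim {A} {f} m
  ... | inj₁ e       = inj₁ e
  ... | inj₂ (a , n) = inj₂ (f a , elemϵ {sup A f} a , n)

  graph-⊆ : ∀ {x y} → x ≋ y → ∀ {e} → e ϵ graph x → e ϵ graph y
  graph-⊆ {sup A f} {sup B g} p m with graph-elim {A} {f} m
  ... | inj₁ e = ϵ-respˡ (≋-trans (⟨⟩-cong (≋-sym p) (check-cong (≋-sym p))) (≋-sym e))
                   (graph-self {sup B g})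
  graph-⊆ {sup A f} {sup B g} (eq (p , _)) m | inj₂ (a , n) =
    let b , q = p a in graph-below {B} {g} b (graph-⊆ (eq q) n)

  graph-mono : ∀ {x y} → y ϵ x → ∀ {e} → e ϵ graph y → e ϵ graph x
  graph-mono {sup A f} (el (a , p)) m = graph-below {A} {f} a (graph-⊆ (eq p) m)

  -- B is a set of pairs ⟨ u , w ⟩ locally satisfying the recursion of check;
  -- by well-foundedness this forces w = check u.
  CheckStep : 𝕍 → 𝕍 → 𝕍 → Set₁
  CheckStep B p s = ∃[ u ] ∃[ w ] (s ≋ ⟨ u , w ⟩
    × (∀ u′ → u′ ϵ u → ∃[ e ] (e ϵ w × ∃[ w′ ] ∃[ q ] (e ≋ ⟨ w′ , q ⟩ × q ≋ p × ⟨ u′ , w′ ⟩ ϵ B)))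
    × (∀ e → e ϵ w → ∃[ u′ ] (u′ ϵ u × ∃[ w′ ] ∃[ q ] (e ≋ ⟨ w′ , q ⟩ × q ≋ p × ⟨ u′ , w′ ⟩ ϵ B))))

  Checks : 𝕍 → 𝕍 → Set₁
  Checks B p = ∀ s → s ϵ B → CheckStep B p s

  Checks-sound : ∀ {B} → Checks B p₀ → ∀ u {w} → ⟨ u , w ⟩ ϵ B → w ≋ check u
  Checks-sound {B} h u@(sup A f) {w} m with h _ m
  ... | u₁ , w₁ , e , down , up = ≋-ext
    (λ {z} k → let u′ , a∈ , w′ , q , ze , qe , n = up z (ϵ-respʳ (⟨⟩-injʳ e) k)
                   a , ae = index {y = u} (ϵ-respʳ (≋-sym (⟨⟩-injˡ e)) a∈)
               in memb {check u} a (≋-trans ze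
                    (⟨⟩-cong (Checks-sound h (f a) (ϵ-respˡ (⟨⟩-cong ae ≋-refl) n)) qe)))
    (λ { (el (a , r)) →
           let z , z∈ , w′ , q , ze , qe , n = down (f a) (ϵ-respʳ (⟨⟩-injˡ e) (elemϵ {u} a))
           in ϵ-respˡ (≋-trans ze (≋-trans (⟨⟩-cong (Checks-sound h (f a) n) qe) (≋-sym (eq r))))
                (ϵ-respʳ (≋-sym (⟨⟩-injʳ e)) z∈) })

  CheckStep-mono : ∀ {B B′ p s} → (∀ {e} → e ϵ B → e ϵ B′) → CheckStep B p s → CheckStep B′ p s
  CheckStep-mono sub (u , w , e , down , up) = u , w , e
    , (λ u′ m → let z , a , w′ , q , b , c , d = down u′ m in z , a , w′ , q , b , c , sub d)
    , (λ z m → let u′ , a , w′ , q , b , c , d = up z m in u′ , a , w′ , q , b , c , sub d)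

  graph-checks : ∀ x → Checks (graph x) p₀
  graph-checks x@(sup A f) s m with graph-elim {A} {f} m
  ... | inj₂ (a , n) = CheckStep-mono (graph-below {A} {f} a) (graph-checks (f a) s n)
  ... | inj₁ e = x , check x , e
    , (λ u m′ → _ , check-intro {x} m′ , check u , p₀ , ≋-refl , ≋-refl , graph-mono {x} m′ graph-self)
    , (λ z m′ → let u , k , r = check-elim {x} m′ in
         u , k , check u , p₀ , r , ≋-refl , graph-mono {x} k graph-self)

  -- A local solution defined at `x` is also defined at the elements of `x`, hence on its whole
  -- transitive closure, and its values there are forced. This characterises `graph x` as the least
  -- such solution and makes it definable.
  graph-least : ∀ {B} → Checks B p₀ → ∀ x {w} → ⟨ x , w ⟩ ϵ B → ∀ {e} → e ϵ graph x → e ϵ B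
  graph-least h x@(sup A f) m k with graph-elim {A} {f} k
  ... | inj₁ r = ϵ-respˡ (≋-trans (⟨⟩-cong ≋-refl (Checks-sound h x m)) (≋-sym r)) m
  ... | inj₂ (a , n) =
    let u , w , e , down , _ = h _ m
        _ , _ , _ , _ , _ , _ , l = down (f a) (ϵ-respʳ (⟨⟩-injˡ e) (elemϵ {x} a))
    in graph-least h (f a) l n

  module _ {V : Class} (M : IsTransitiveModel V) (Vp₀ : V p₀) where

    open Model M

    -- Its semantics unfolds to `Checks` definitionally. Seven variables are bound above the
    -- innermost atoms, whence `s⁷`.
    checksᶠ : ∀ {n} → Fin n → Fin n → Fm n
    checksᶠ b p = ∀∈ b (∃⟨⟩ 0F
      ( ∀∈ 1F (∃∈ 1F (∃⟨⟩ 0F ((0F ≈ᶠ s⁷ p) ∧ᶠ ⟪ 3F , 1F ⟫∈ᶠ s⁷ b)))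
      ∧ᶠ ∀∈ 0F (∃∈ 2F (∃⟨⟩ 1F ((0F ≈ᶠ s⁷ p) ∧ᶠ ⟪ 2F , 1F ⟫∈ᶠ s⁷ b)))))
      where
      s⁷ : ∀ {n} → Fin n → Fin (suc (suc (suc (suc (suc (suc (suc n)))))))
      s⁷ i = suc (suc (suc (suc (suc (suc (suc i))))))

    -- z is the least solution B of Checks with y in its domain.
    graphᶠ : Fm 3
    graphᶠ = checksᶠ 0F 2F ∧ᶠ ∃V (⟪ 2F , 0F ⟫∈ᶠ 1F)
      ∧ᶠ ∀V ((checksᶠ 0F 3F ∧ᶠ ∃V (⟪ 3F , 0F ⟫∈ᶠ 1F)) ⇒ᶠ ∀∈ 1F (0F ∈ᶠ 1F))

    module _ {y} (Vg : V (graph y)) where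

      V-check : V (check y)
      V-check = V-snd (V-elem Vg graph-self)

      graphᶠ-complete : ⟦ graphᶠ ⟧ (graph y ∷ y ∷ p₀ ∷ [])
      graphᶠ-complete = graph-checks y , (check y , V-check , graph-self)
        , λ B _ (c , w , _ , m) e → graph-least c y m

      graphᶠ-sound : ∀ {z} → ⟦ graphᶠ ⟧ (z ∷ y ∷ p₀ ∷ []) → z ≋ graph y
      graphᶠ-sound (c , (w , _ , m) , least) = ≋-ext
        (λ {e} → least (graph y) Vg (graph-checks y , check y , V-check , graph-self) e)
        (graph-least c y m)

    -- `graph x` is the union of the graphs of the elements of `x`, obtained by replacement,
    -- together with one pair at the top. That pair needs `check x`, which a second replacement
    -- reads off from the union.
    V-graph-step : ∀ {x} → V x → (∀ {y} → y ϵ x → V (graph y)) → V (graph x)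
    V-graph-step {x} vx Vg = V-resp (≋-ext into out) (V-∪ vu (V-｛｝ Vself Vself))
      where
      graphs = image graphᶠ (Vp₀ ∷ []) vx (λ {y} _ → graph y) Vg
        (λ {y} m → graphᶠ-complete {y} (Vg m))
        (λ {y} {z} m → graphᶠ-sound {y} (Vg m) {z})
      union : ∃[ u ] (V u × (∀ {e} → e ϵ u → ∃[ g ] (g ϵ proj₁ graphs × e ϵ g))
                          × (∀ {g e} → g ϵ proj₁ graphs → e ϵ g → e ϵ u))
      union = ⋃-exists (proj₁ (proj₂ graphs))
      u = proj₁ union
      vu = proj₁ (proj₂ union)
      in-u : ∀ {y e} → y ϵ x → e ϵ graph y → e ϵ u
      in-u m = proj₂ (proj₂ (proj₂ union)) (proj₂ (proj₂ (proj₂ graphs)) m)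
      from-u : ∀ {e} → e ϵ u → ∃[ y ] (y ϵ x × e ϵ graph y)
      from-u n =
        let g , k , l = proj₁ (proj₂ (proj₂ union)) n
            y , m , p = proj₁ (proj₂ (proj₂ graphs)) k
        in y , m , ϵ-respʳ p l
      u-check : ∀ {y w} → ⟨ y , w ⟩ ϵ u → w ≋ check y
      u-check n = let y , _ , k = from-u n in Checks-sound (graph-checks y) _ k
      -- z = ⟨ w , p₀ ⟩ for some w with ⟨ y , w ⟩ ∈ u
      checks = image (∃V (⟪ 2F , 0F ⟫∈ᶠ 3F ∧ᶠ ∃⟨⟩ 1F (1F ≈ᶠ 2F ∧ᶠ 0F ≈ᶠ 6F)))
        (vu ∷ Vp₀ ∷ []) vx (λ {y} _ → ⟨ check y , p₀ ⟩)
        (λ m → V-⟨⟩ (V-check (Vg m)) Vp₀)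
        (λ {y} m → check y , V-check (Vg m) , in-u m graph-self
          , check y , p₀ , ≋-refl , ≋-refl , ≋-refl)
        (λ { m (w , _ , n , a , b , e , p , q) →
          ≋-trans e (⟨⟩-cong (≋-trans p (u-check n)) q) })
      c≋check : proj₁ checks ≋ check x
      c≋check = let _ , _ , c-elim , c-intro = checks in ≋-ext
        (λ m → let y , k , e = c-elim m in ϵ-respˡ (≋-sym e) (check-intro k))
        (λ m → let y , k , e = check-elim m in ϵ-respˡ (≋-sym e) (c-intro k))
      Vself : V ⟨ x , check x ⟩
      Vself = V-⟨⟩ vx (V-resp c≋check (proj₁ (proj₂ checks)))
      into : ∀ {e} → e ϵ u ∪ ｛ ⟨ x , check x ⟩ , ⟨ x , check x ⟩ ｝ → e ϵ graph x
      into m = [ (λ n → let y , k , l = from-u n in graph-mono {x} k l)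
               , (λ n → ϵ-respˡ (≋-sym ([ id , id ]′ (｛｝-elim n))) (graph-self {x})) ]′ (∪-elim m)
      out : ∀ {e} → e ϵ graph x → e ϵ u ∪ ｛ ⟨ x , check x ⟩ , ⟨ x , check x ⟩ ｝
      out m = [ (λ e → ∪-introʳ {u} (｛｝-introˡ e))
              , (λ { (y , k , n) → ∪-introˡ (in-u k n) }) ]′ (graph-elim′ m)

    -- External ∈-induction. An element of `x` is some `f a` only up to `≋`, so its graph is
    -- transferred from that of `f a`.
    V-graph : ∀ x → V x → V (graph x)
    V-graph x@(sup A f) vx = V-graph-step vx λ { {y} (el (a , p)) →
      V-resp (≋-ext (graph-⊆ (≋-sym (eq p))) (graph-⊆ (eq p)))
        (V-graph (f a) (V-elem vx (elemϵ {x} a))) }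

-- Finite maps between structures

infix 4 _⊨_·_
_⊨_·_ : Structure → 𝕍 → ∀ {k} → (Fin k → 𝕍) → Set₁
𝒜 ⊨ R · v = ⟨ R , tuple v ⟩ ϵ rel 𝒜

⊨-cong : ∀ 𝒜 R {k} {v w : Fin k → 𝕍} → (∀ i → v i ≋ w i) → 𝒜 ⊨ R · v ⇔ 𝒜 ⊨ R · w
⊨-cong 𝒜 R e = mk⇔
  (ϵ-respˡ (⟨⟩-cong ≋-refl (tuple-cong e)))
  (ϵ-respˡ (⟨⟩-cong ≋-refl (tuple-cong (≋-sym ∘ e))))

Holds⇔ : ∀ {𝒜 ℬ R k} {v w : Fin k → 𝕍} → 𝒜 ⊨ R · v ⇔ ℬ ⊨ R · w → Holds 𝒜 R v ⇔ Holds ℬ R w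
Holds⇔ h = mk⇔ (unϵ ∘ to h ∘ el) (unϵ ∘ from h ∘ el)

⊨⇔ : ∀ {𝒜 ℬ R k} {v w : Fin k → 𝕍} → Holds 𝒜 R v ⇔ Holds ℬ R w → 𝒜 ⊨ R · v ⇔ ℬ ⊨ R · w
⊨⇔ h = mk⇔ (el ∘ to h ∘ unϵ) (el ∘ from h ∘ unϵ)

enum : ∀ {n} → (Fin n → 𝕍) → 𝕍
enum = sup (Fin _)

pairs : ∀ {n} → (Fin n → 𝕍) → (Fin n → 𝕍) → 𝕍
pairs a b = enum λ i → ⟨ a i , b i ⟩

pairs-intro : ∀ {n} (a b : Fin n → 𝕍) i → ⟨ a i , b i ⟩ ϵ pairs a b
pairs-intro a b i = elemϵ {pairs a b} i

pairs-elim : ∀ {n} {a b : Fin n → 𝕍} {x y} → ⟨ x , y ⟩ ϵ pairs a b →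
  Σ[ i ∈ Fin n ] (x ≋ a i × y ≋ b i)
pairs-elim (el (i , e)) = i , ⟨⟩-injˡ (eq e) , ⟨⟩-injʳ (eq e)

Distinct : ∀ {n} → (Fin n → 𝕍) → Set₁
Distinct a = ∀ i j → a i ≋ a j → i ≡ j

-- Enumerations may repeat elements, so the assignment of `b i` to `a i` is a well-defined injection
-- only if equalities transfer in both directions.
record Matching {n} (a b : Fin n → 𝕍) : Set₁ where
  field
    there : ∀ {i j} → a i ≋ a j → b i ≋ b j
    back  : ∀ {i j} → b i ≋ b j → a i ≋ a j

open Matching

matching-refl : ∀ {n} {a : Fin n → 𝕍} → Matching a a
matching-refl = record { there = id ; back = id }

matching-sym : ∀ {n} {a b : Fin n → 𝕍} → Matching a b → Matching b a
matching-sym m = record { there = back m ; back = there m }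

distinct-matching : ∀ {n} {a b : Fin n → 𝕍} → Distinct a → Distinct b → Matching a b
distinct-matching {a = a} {b} da db = record
  { there = λ {i} {j} e → subst (λ k → b i ≋ b k) (da i j e) ≋-refl
  ; back  = λ {i} {j} e → subst (λ k → a i ≋ a k) (db i j e) ≋-refl
  }

module _ {L : 𝕍} {𝒜 ℬ : Structure} {n} {a b : Fin n → 𝕍} (m : Matching a b) where

  pairs-embedding : dom 𝒜 ≋ enum a → (∀ i → b i ϵ dom ℬ) →
    (∀ R k → ⟨ R , nat k ⟩ ∈ L → (g : Fin k → Fin n) → 𝒜 ⊨ R · (a ∘ g) ⇔ ℬ ⊨ R · (b ∘ g)) →
    Embedding L 𝒜 ℬ (pairs a b)
  pairs-embedding domA bϵ h = record
    { isFunction = record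
      { graph = λ { e (i , p) → a i , b i
          , unϵ (ϵ-respʳ (≋-sym domA) (elemϵ {enum a} i)) , unϵ (bϵ i) , p }
      ; total = λ x xϵ → let i , p = index (ϵ-respʳ {x = x} domA (el xϵ)) in
          b i , unϵ (ϵ-respˡ (⟨⟩-cong (≋-sym p) ≋-refl) (pairs-intro a b i))
      ; functional = λ x y z p q →
          let i , xi , yi = pairs-elim {a = a} {b} (el p)
              j , xj , zj = pairs-elim {a = a} {b} (el q)
          in un≋ (≋-trans yi (≋-trans (there m (≋-trans (≋-sym xi) xj)) (≋-sym zj)))
      }
    ; injective = λ x y z p q →
          let i , xi , zi = pairs-elim {a = a} {b} (el p)
              j , yj , zj = pairs-elim {a = a} {b} (el q)
          in un≋ (≋-trans xi (≋-trans (back m (≋-trans (≋-sym zi) zj)) (≋-sym yj)))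
    ; preserves = λ R k Rk v w f →
          let l = λ i → pairs-elim {a = a} {b} (el (f i)) in
          Holds⇔ {𝒜} {ℬ} (⊨-cong ℬ R (λ i → ≋-sym (proj₂ (proj₂ (l i))))
            ⇔-∘ (h R k Rk (proj₁ ∘ l)
            ⇔-∘ ⊨-cong 𝒜 R (λ i → proj₁ (proj₂ (l i)))))
    }

-- A tuple is a set of pairs of a position and a value. Here `u` and `u′` are entries at the same
-- position whose values correspond under `j`; comparing tuples entry by entry avoids any mention of
-- their length.
Shifted : 𝕍 → 𝕍 → 𝕍 → Set₁
Shifted j u u′ = ∃[ i ] ∃[ x ] (u ≋ ⟨ i , x ⟩ ×
  (∃[ i′ ] ∃[ y ] (u′ ≋ ⟨ i′ , y ⟩ × i′ ≋ i × ⟨ x , y ⟩ ϵ j)))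

module Shift {n} (a b : Fin n → 𝕍) where

  shift : ∀ {i u u′} l → u ≋ ⟨ i , a l ⟩ → u′ ≋ ⟨ i , b l ⟩ → Shifted (pairs a b) u u′
  shift l p q = _ , _ , p , _ , _ , q , ≋-refl , pairs-intro a b l

  shiftʳ : Matching a b → ∀ {i u u′} l → u ≋ ⟨ i , a l ⟩ →
    Shifted (pairs a b) u u′ → u′ ≋ ⟨ i , b l ⟩
  shiftʳ m l p (_ , _ , q , _ , _ , r , s , t) =
    let l′ , x , y = pairs-elim t
        e = ≋-trans (≋-sym p) q
    in ≋-trans r (⟨⟩-cong (≋-trans s (≋-sym (⟨⟩-injˡ e)))
         (≋-trans y (there m (≋-trans (≋-sym x) (≋-sym (⟨⟩-injʳ e))))))

  shiftˡ : Matching a b → ∀ {i u u′} l → u′ ≋ ⟨ i , b l ⟩ →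
    Shifted (pairs a b) u u′ → u ≋ ⟨ i , a l ⟩
  shiftˡ m l p (_ , _ , q , _ , _ , r , s , t) =
    let l′ , x , y = pairs-elim t
        e = ≋-trans (≋-sym p) r
    in ≋-trans q (⟨⟩-cong (≋-trans (≋-sym s) (≋-sym (⟨⟩-injˡ e)))
         (≋-trans x (back m (≋-trans (≋-sym y) (≋-sym (⟨⟩-injʳ e))))))

  shift-origin : ∀ {u u′} → Shifted (pairs a b) u u′ → Σ[ l ∈ Fin n ] ∃[ i ] (u′ ≋ ⟨ i , b l ⟩)
  shift-origin (_ , _ , q , _ , _ , r , s , t) =
    let l , x , y = pairs-elim t in l , _ , ≋-trans r (⟨⟩-cong ≋-refl y)

-- Structures of the model pulled back along finite maps.

module Language {V : Class} (M : IsTransitiveModel V) {L : 𝕍} (VL : V L) where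

  open Model M

  abstract
    -- `R` lies in ⋃⋃L because it is the first component of an element of `L`, and a tuple over `X`
    -- is a subset of ω × X.
    atom-bound : ∀ {X} → V X → ∃[ B ] (V B ×
      (∀ R k → ⟨ R , nat k ⟩ ∈ L → (v : Fin k → 𝕍) → (∀ i → v i ϵ X) → ⟨ R , tuple v ⟩ ϵ B))
    atom-bound VX =
      let w , vw , wi = ω-bound
          P , vP , Pi = product-bound vw VX
          Q , vQ , Qi = power-bound vP
          _ , vU , _ , Ui = ⋃-exists VL
          _ , vU′ , _ , Ui′ = ⋃-exists vU
          B , vB , Bi = product-bound vU′ vQ
      in B , vB , λ R k Rk v m → Bi
           (Ui′ (Ui (el Rk) (｛｝-introˡ ≋-refl)) (｛｝-introˡ ≋-refl))
           (Qi (V-tuple v (λ i → V-elem VX (m i)))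
             λ { (el (i , p)) → ϵ-respˡ (≋-sym (eq p)) (Pi (wi (toℕ i)) (m i)) })

  shiftedᶠ : ∀ {n} → Fin n → Fin n → Fin n → Fm n
  shiftedᶠ j u u′ = ∃⟨⟩ u (∃⟨⟩ (suc (suc u′))
    (1F ≈ᶠ 3F ∧ᶠ ⟪ 2F , 0F ⟫∈ᶠ suc (suc (suc (suc j)))))

  module _ {𝒩 : Structure} (V𝒩 : V (code 𝒩)) (S𝒩 : IsStructure L 𝒩)
           {n} {a b : Fin n → 𝕍} (Va : ∀ i → V (a i)) (bϵ : ∀ i → b i ϵ dom 𝒩)
           (m : Matching a b) where

    open Shift a b

    -- Separation keeps the atoms over `a` whose entrywise shift along `pairs a b` belongs to
    -- `rel 𝒩`; one formula serves all arities.
    pullback : ∃[ r ] (V ⟨ enum a , r ⟩ × IsStructure L (structure (enum a) r)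
      × (∀ R k → ⟨ R , nat k ⟩ ∈ L → (g : Fin k → Fin n) →
           structure (enum a) r ⊨ R · (a ∘ g) ⇔ 𝒩 ⊨ R · (b ∘ g)))
    pullback = r , V-⟨⟩ Venum Vr , isStructure , holds
      where
      Venum : V (enum a)
      Venum = V-finite a Va
      Vb : ∀ i → V (b i)
      Vb i = V-elem (V-fst V𝒩) (bϵ i)
      bound = atom-bound Venum
      separated = separate
        (∃⟨⟩ 0F (∃V (⟪ 2F , 0F ⟫∈ᶠ 4F
          ∧ᶠ ∀∈ 1F (∃∈ 1F (shiftedᶠ (# 7) 1F 0F))
          ∧ᶠ ∀∈ 0F (∃∈ 2F (shiftedᶠ (# 7) 0F 1F)))))
        {rel 𝒩 ∷ pairs a b ∷ []}
        (V-snd V𝒩 ∷ V-finite _ (λ i → V-⟨⟩ (Va i) (Vb i)) ∷ [])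
        (proj₁ (proj₂ bound))
      r = proj₁ separated
      Vr : V r
      Vr = proj₁ (proj₂ separated)
      elim : ∀ {e} → e ϵ r → ∃[ R ] ∃[ t ] (e ≋ ⟨ R , t ⟩ × (∃[ t′ ] (V t′ × ⟨ R , t′ ⟩ ϵ rel 𝒩
        × (∀ u → u ϵ t → ∃[ u′ ] (u′ ϵ t′ × Shifted (pairs a b) u u′))
        × (∀ u′ → u′ ϵ t′ → ∃[ u ] (u ϵ t × Shifted (pairs a b) u u′)))))
      elim e = proj₂ (proj₁ (proj₂ (proj₂ separated)) e)

      holds : ∀ R k → ⟨ R , nat k ⟩ ∈ L → (g : Fin k → Fin n) →
        structure (enum a) r ⊨ R · (a ∘ g) ⇔ 𝒩 ⊨ R · (b ∘ g)
      holds R k Rk g = mk⇔ down up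
        where
        down : ⟨ R , tuple (a ∘ g) ⟩ ϵ r → ⟨ R , tuple (b ∘ g) ⟩ ϵ rel 𝒩
        down e with elim e
        ... | R′ , t , p , t′ , _ , q , f , f′ = ϵ-respˡ
          (⟨⟩-cong (≋-sym (⟨⟩-injˡ p)) (≋-ext
            (λ {u′} k → let u , l , s = f′ u′ k
                            i , z = index {y = tuple (a ∘ g)} (ϵ-respʳ (≋-sym (⟨⟩-injʳ p)) l)
                        in memb i (shiftʳ m (g i) z s))
            (λ { (el (i , z)) →
                 let u′ , l , s = f ⟨ nat (toℕ i) , a (g i) ⟩
                       (ϵ-respʳ (⟨⟩-injʳ p) (elemϵ {tuple (a ∘ g)} i))
                 in ϵ-respˡ (≋-trans (shiftʳ m (g i) ≋-refl s) (≋-sym (eq z))) l })))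
          q
        up : ⟨ R , tuple (b ∘ g) ⟩ ϵ rel 𝒩 → ⟨ R , tuple (a ∘ g) ⟩ ϵ r
        up e = proj₂ (proj₂ (proj₂ separated))
          (proj₂ (proj₂ bound) R k Rk (a ∘ g) (λ i → elemϵ {enum a} (g i)))
          ( R , tuple (a ∘ g) , ≋-refl , tuple (b ∘ g) , V-tuple (b ∘ g) (λ i → Vb (g i)) , e
          , (λ { u (el (i , z)) → _ , elemϵ {tuple (b ∘ g)} i , shift (g i) (eq z) ≋-refl })
          , (λ { u (el (i , z)) → _ , elemϵ {tuple (a ∘ g)} i , shift (g i) ≋-refl (eq z) }) )

      isStructure : IsStructure L (structure (enum a) r)
      isStructure e e∈ with elim (el e∈)
      -- The separating formula does not say that `t` is a tuple. Length and shape are recovered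
      -- from the shifted atom, which belongs to the structure `𝒩`.
      ... | R , t , p , t′ , _ , q , f , f′ with S𝒩 _ (unϵ q)
      ...   | R′ , k , w , R′k , wϵ , z = R′ , k , a ∘ l
        , R′k , (λ i → unϵ (elemϵ {enum a} (l i)))
        , un≋ (≋-trans p (⟨⟩-cong (⟨⟩-injˡ (eq z)) (≋-ext into out)))
        where
        t′≋ : t′ ≋ tuple w
        t′≋ = ⟨⟩-injʳ (eq z)
        source : ∀ i → ∃[ u ] (u ϵ t × Shifted (pairs a b) u ⟨ nat (toℕ i) , w i ⟩)
        source i = f′ _ (ϵ-respʳ (≋-sym t′≋) (elemϵ {tuple w} i))
        origin : ∀ i → Σ[ l ∈ Fin n ] ∃[ c ] (⟨ nat (toℕ i) , w i ⟩ ≋ ⟨ c , b l ⟩)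
        origin i = shift-origin (proj₂ (proj₂ (source i)))
        l : Fin k → Fin n
        l i = proj₁ (origin i)
        w≋ : ∀ i → ⟨ nat (toℕ i) , w i ⟩ ≋ ⟨ nat (toℕ i) , b (l i) ⟩
        w≋ i = ⟨⟩-cong ≋-refl (⟨⟩-injʳ (proj₂ (proj₂ (origin i))))
        into : ∀ {u} → u ϵ t → u ϵ tuple (a ∘ l)
        into {u} c =
          let u′ , c′ , s = f u c
              i , y = index {y = tuple w} (ϵ-respʳ t′≋ c′)
          in memb i (shiftˡ m (l i) (≋-trans y (w≋ i)) s)
        out : ∀ {u} → u ϵ tuple (a ∘ l) → u ϵ t
        out (el (i , y)) =
          let u , c , s = source i in
          ϵ-respˡ (≋-trans (shiftˡ m (l i) (w≋ i) s) (≋-sym (eq y))) c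

-- One-point extensions in a strong Fraïssé class

module FraïsséClass (em : ExcludedMiddle (lsuc 0ℓ)) {V : Class} (M : IsTransitiveModel V)
  {L : 𝕍} (VL : V L) {K : Class} (isClass : IsClassOf V K) (SF : StrongFraïssé V L K) where

  open Model M
  open Language M VL
  open StrongFraïssé SF

  by-contradiction : {P : Set₁} → ¬ ¬ P → P
  by-contradiction {P} h with em {P}
  ... | yes p = p
  ... | no ¬p = ⊥-elim (h ¬p)

  K⊆V : ∀ {x} → K x → V x
  K⊆V {x} = proj₁ isClass x

  -- `K` is a bare predicate on sets; its invariance under set equality comes from the formula
  -- defining it.
  K-resp : ∀ {x y} → x ≋ y → K x → K y
  K-resp {x} {y} e k =
    let _ , n , φ , ρ , _ , h = isClass ; vx = K⊆V k in
    from (h y (V-resp e vx))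
      (Sat-cong φ (λ { zero → e ; (suc i) → ≋-refl }) (to (h x vx) k))

  K-structure : ∀ {𝒜} → K (code 𝒜) → IsStructure L 𝒜
  K-structure {𝒜} k e e∈ =
    let 𝒜′ , c , s , _ = finiteStructures _ k
        d = ⟨⟩-injˡ {dom 𝒜} (eq c)
        R , n , v , Rn , vϵ , p = s e (unϵ (ϵ-respʳ {e} (⟨⟩-injʳ {dom 𝒜} (eq c)) (el e∈)))
    in R , n , v , Rn , (λ i → unϵ (ϵ-respʳ (≋-sym d) (el (vϵ i)))) , p

  K-finite : ∀ {𝒜} → K (code 𝒜) → Σ[ n ∈ ℕ ] Σ[ a ∈ (Fin n → 𝕍) ] dom 𝒜 ≋ enum a
  K-finite {𝒜} k =
    let 𝒜′ , c , _ , n , a , p = finiteStructures _ k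
    in n , a , ≋-trans (⟨⟩-injˡ {dom 𝒜} (eq c)) (eq p)

  Pullback : Structure → ∀ {n} → (Fin n → 𝕍) → (Fin n → 𝕍) → Set₁
  Pullback 𝒩 {n} a b =
    ∃[ r ] (K ⟨ enum a , r ⟩ × (∀ R k → ⟨ R , nat k ⟩ ∈ L → (g : Fin k → Fin n) →
      structure (enum a) r ⊨ R · (a ∘ g) ⇔ 𝒩 ⊨ R · (b ∘ g)))

  -- HP puts into `K` the substructure of `𝒩` on the range of `b`, itself a pullback along the
  -- identity; closure under isomorphism then renames its points to `a`.
  transport : ∀ {𝒩} → K (code 𝒩) → ∀ {n} {a b : Fin n → 𝕍} →
    (∀ i → V (a i)) → (∀ i → b i ϵ dom 𝒩) → Matching a b → Pullback 𝒩 a b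
  transport {𝒩} K𝒩 {n} {a} {b} Va bϵ m =
    proj₁ pull , isoClosed ℐ 𝒜 (pairs b a) Kℐ (proj₁ (proj₂ pull)) (proj₁ (proj₂ (proj₂ pull)))
      (V-finite _ (λ i → V-⟨⟩ (Vb i) (Va i)))
      ( pairs-embedding (matching-sym m) ≋-refl (λ i → elemϵ {enum a} i)
          (λ R k Rk g → ⇔-sym (holds R k Rk g) ⇔-∘ image-holds R k Rk g)
      , (λ { y (i , p) → b i , unϵ (ϵ-respˡ (⟨⟩-cong ≋-refl (≋-sym (eq p))) (pairs-intro b a i)) }) )
    , holds
    where
    Vb : ∀ i → V (b i)
    Vb i = V-elem (V-fst (K⊆V K𝒩)) (bϵ i)
    pull = pullback {𝒩 = 𝒩} (K⊆V K𝒩) (K-structure K𝒩) Va bϵ m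
    image-pull = pullback {𝒩 = 𝒩} (K⊆V K𝒩) (K-structure K𝒩) Vb bϵ matching-refl
    𝒜 ℐ : Structure
    𝒜 = structure (enum a) (proj₁ pull)
    ℐ = structure (enum b) (proj₁ image-pull)
    holds : ∀ R k → ⟨ R , nat k ⟩ ∈ L → (g : Fin k → Fin n) → 𝒜 ⊨ R · (a ∘ g) ⇔ 𝒩 ⊨ R · (b ∘ g)
    holds = proj₂ (proj₂ (proj₂ pull))
    image-holds : ∀ R k → ⟨ R , nat k ⟩ ∈ L → (g : Fin k → Fin n) →
      ℐ ⊨ R · (b ∘ g) ⇔ 𝒩 ⊨ R · (b ∘ g)
    image-holds = proj₂ (proj₂ (proj₂ image-pull))
    Kℐ : K (code ℐ)
    Kℐ = HP ℐ 𝒩 K𝒩 (proj₁ (proj₂ image-pull)) record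
      { isStructure = proj₁ (proj₂ (proj₂ image-pull))
      ; dom⊆ = λ { z (i , p) → unϵ (ϵ-respˡ (≋-sym (eq p)) (bϵ i)) }
      ; induced = λ R k Rk v vϵ → Holds⇔ {ℐ} {𝒩}
          (⊨-cong 𝒩 R (λ i → ≋-sym (eq (proj₂ (vϵ i))))
          ⇔-∘ (image-holds R k Rk (proj₁ ∘ vϵ)
          ⇔-∘ ⊨-cong ℐ R (λ i → eq (proj₂ (vϵ i)))))
      }

  abstract
    K-pullback : ∀ {𝒩} → K (code 𝒩) → ∀ {n} {a b : Fin n → 𝕍} →
      (∀ i → V (a i)) → (∀ i → b i ϵ dom 𝒩) → Matching a b → Pullback 𝒩 a b
    K-pullback = transport

  -- One implication suffices, as the two structures can be exchanged.
  Homogeneous : ℕ → Set₁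
  Homogeneous n = ∀ R k → ⟨ R , nat k ⟩ ∈ L → (f : Fin k → Fin n) →
    ∀ {𝒜 ℬ} → K (code 𝒜) → K (code ℬ) → {a b : Fin n → 𝕍} →
    (∀ i → a i ϵ dom 𝒜) → (∀ i → b i ϵ dom ℬ) → Distinct a → Distinct b →
    𝒜 ⊨ R · (a ∘ f) → ℬ ⊨ R · (b ∘ f)

  record _≼_ (𝒜 ℬ : Structure) : Set₁ where
    field
      sub  : ∀ {z} → z ϵ dom 𝒜 → z ϵ dom ℬ
      same : ∀ {R k} → ⟨ R , nat k ⟩ ∈ L → {v : Fin k → 𝕍} → (∀ i → v i ϵ dom 𝒜) →
             𝒜 ⊨ R · v ⇔ ℬ ⊨ R · v

  open _≼_ public

  ≼-refl : ∀ {𝒜} → 𝒜 ≼ 𝒜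
  ≼-refl = record { sub = id ; same = λ _ _ → mk⇔ id id }

  ≼-trans : ∀ {𝒜 ℬ 𝒞} → 𝒜 ≼ ℬ → ℬ ≼ 𝒞 → 𝒜 ≼ 𝒞
  ≼-trans p q = record
    { sub  = sub q ∘ sub p
    ; same = λ Rk vϵ → same q Rk (sub p ∘ vϵ) ⇔-∘ same p Rk vϵ }

  ≼⇒Substructure : ∀ {𝒜 ℬ} → K (code 𝒜) → 𝒜 ≼ ℬ → Substructure L 𝒜 ℬ
  ≼⇒Substructure {𝒜} {ℬ} K𝒜 p = record
    { isStructure = K-structure K𝒜
    ; dom⊆        = λ z z∈ → unϵ (sub p (el z∈))
    ; induced     = λ R k Rk v vϵ → Holds⇔ {𝒜} {ℬ} (same p Rk (el ∘ vϵ)) }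

  Substructure⇒≼ : ∀ {𝒜 ℬ} → Substructure L 𝒜 ℬ → 𝒜 ≼ ℬ
  Substructure⇒≼ {𝒜} {ℬ} s = record
    { sub  = λ z∈ → el (Substructure.dom⊆ s _ (unϵ z∈))
    ; same = λ Rk vϵ → ⊨⇔ {𝒜} {ℬ} (Substructure.induced s _ _ Rk _ (unϵ ∘ vϵ)) }

  -- `b zero` is the pattern for the new point `x`, and `b (suc i)` the pattern for `c i`: the tuple
  -- `x ◂ c` satisfies in `𝒜′` the same atomic relations as `b` in `ℬ`.
  OnePointExtension : ∀ {n} (𝒜 ℬ : Structure) → (Fin n → 𝕍) → (Fin (suc n) → 𝕍) → 𝕍 → Set₁
  OnePointExtension {n} 𝒜 ℬ c b x =
    ∃[ 𝒜′ ] (K (code 𝒜′) × 𝒜 ≼ 𝒜′ × x ϵ dom 𝒜′ × (∀ {z} → z ϵ dom 𝒜′ → z ϵ dom 𝒜 ⊎ z ≋ x)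
      × (∀ {R k} → ⟨ R , nat k ⟩ ∈ L → (g : Fin k → Fin (suc n)) →
           𝒜′ ⊨ R · ((x ◂ c) ∘ g) ⇔ ℬ ⊨ R · (b ∘ g)))

  -- The subset of an amalgam ℳ₃ consisting of 𝒜 and the image of b₀, with the
  -- latter point renamed to x.
  module Glue {n} {𝒜 ℬ ℳ₃} (K𝒜 : K (code 𝒜)) (Kℳ₃ : K (code ℳ₃))
    {N} {a : Fin N → 𝕍} (dom𝒜 : dom 𝒜 ≋ enum a)
    {j₁ j₂} (E₁ : Embedding L 𝒜 ℳ₃ j₁) (E₂ : Embedding L ℬ ℳ₃ j₂)
    {c : Fin n → 𝕍} (cϵ : ∀ i → c i ϵ dom 𝒜)
    {b : Fin (suc n) → 𝕍} (bϵ : ∀ i → b i ϵ dom ℬ)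
    (joined : ∀ i → ∃[ w ] (⟨ c i , w ⟩ ϵ j₁ × ⟨ b (suc i) , w ⟩ ϵ j₂))
    (new : ∀ u {w} → ⟨ u , w ⟩ ϵ j₁ → ¬ ⟨ b zero , w ⟩ ϵ j₂)
    {x} (Vx : V x) (x∉ : ¬ x ϵ dom 𝒜) where

    module E₁ = Embedding E₁
    module E₂ = Embedding E₂

    aϵ : ∀ i → a i ϵ dom 𝒜
    aϵ i = ϵ-respʳ (≋-sym dom𝒜) (elemϵ {enum a} i)
    y : Fin N → 𝕍
    y i = proj₁ (IsFunction.total E₁.isFunction (a i) (unϵ (aϵ i)))
    ay : ∀ i → ⟨ a i , y i ⟩ ϵ j₁
    ay i = el (proj₂ (IsFunction.total E₁.isFunction (a i) (unϵ (aϵ i))))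
    z : 𝕍
    z = proj₁ (IsFunction.total E₂.isFunction (b zero) (unϵ (bϵ zero)))
    bz : ⟨ b zero , z ⟩ ϵ j₂
    bz = el (proj₂ (IsFunction.total E₂.isFunction (b zero) (unϵ (bϵ zero))))

    a′ b′ : Fin (suc N) → 𝕍
    a′ = x ◂ a
    b′ = z ◂ y

    in-range : ∀ {A f u v} → IsFunction f A (dom ℳ₃) → ⟨ u , v ⟩ ϵ f → v ϵ dom ℳ₃
    in-range F m = let _ , _ , _ , q , e = IsFunction.graph F _ (unϵ m) in
      ϵ-respˡ (≋-sym (⟨⟩-injʳ (eq e))) (el q)

    z≉y : ∀ i → ¬ z ≋ y i
    z≉y i e = new (a i) (ϵ-respˡ (⟨⟩-cong ≋-refl (≋-sym e)) (ay i)) bz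

    -- `x` is outside `𝒜` and `z` is outside the image of `𝒜`, so sending `x` to `z` keeps j₁ a
    -- well-defined injection.
    matching : Matching a′ b′
    matching = record { there = λ {i} {j} → there′ i j ; back = λ {i} {j} → back′ i j }
      where
      there′ : ∀ i j → a′ i ≋ a′ j → b′ i ≋ b′ j
      there′ zero    zero    _ = ≋-refl
      there′ zero    (suc j) e = ⊥-elim (x∉ (ϵ-respˡ (≋-sym e) (aϵ j)))
      there′ (suc i) zero    e = ⊥-elim (x∉ (ϵ-respˡ e (aϵ i)))
      there′ (suc i) (suc j) e = eq (IsFunction.functional E₁.isFunction _ _ _
        (unϵ (ay i)) (unϵ (ϵ-respˡ (⟨⟩-cong (≋-sym e) ≋-refl) (ay j))))
      back′ : ∀ i j → b′ i ≋ b′ j → a′ i ≋ a′ j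
      back′ zero    zero    _ = ≋-refl
      back′ zero    (suc j) e = ⊥-elim (z≉y j e)
      back′ (suc i) zero    e = ⊥-elim (z≉y i (≋-sym e))
      back′ (suc i) (suc j) e = eq (E₁.injective _ _ _
        (unϵ (ay i)) (unϵ (ϵ-respˡ (⟨⟩-cong ≋-refl (≋-sym e)) (ay j))))

    pull : Pullback ℳ₃ a′ b′
    pull = K-pullback {ℳ₃} Kℳ₃ {a = a′} {b′}
      (λ { zero → Vx ; (suc i) → V-elem (V-fst (K⊆V K𝒜)) (aϵ i) })
      (λ { zero → in-range E₂.isFunction bz ; (suc i) → in-range E₁.isFunction (ay i) })
      matching
    𝒜′ : Structure
    𝒜′ = structure (enum a′) (proj₁ pull)
    holds : ∀ R k → ⟨ R , nat k ⟩ ∈ L → (g : Fin k → Fin (suc N)) →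
      𝒜′ ⊨ R · (a′ ∘ g) ⇔ ℳ₃ ⊨ R · (b′ ∘ g)
    holds = proj₂ (proj₂ pull)

    dom-elim : ∀ {w} → w ϵ enum a′ → w ϵ dom 𝒜 ⊎ w ≋ x
    dom-elim (el (zero , p))  = inj₂ (eq p)
    dom-elim (el (suc i , p)) = inj₁ (ϵ-respˡ (≋-sym (eq p)) (aϵ i))

    position : ∀ {w} → w ϵ dom 𝒜 → Σ[ i ∈ Fin N ] w ≋ a i
    position m = index (ϵ-respʳ dom𝒜 m)

    𝒜≼𝒜′ : 𝒜 ≼ 𝒜′
    𝒜≼𝒜′ = record
      { sub  = λ m → let i , p = position m in memb {enum a′} (suc i) p
      ; same = λ {R} {k} Rk {v} vϵ →
          let g = λ i → proj₁ (position (vϵ i)) ; v≋ = λ i → proj₂ (position (vϵ i)) in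
          ⊨-cong 𝒜′ R (≋-sym ∘ v≋)
          ⇔-∘ (⇔-sym (holds R k Rk (suc ∘ g))
          ⇔-∘ (⊨⇔ {𝒜} {ℳ₃} (E₁.preserves R k Rk (a ∘ g) (y ∘ g) (λ i → unϵ (ay (g i))))
          ⇔-∘ ⊨-cong 𝒜 R v≋))
      }

    h : Fin (suc n) → Fin (suc N)
    h zero    = zero
    h (suc i) = suc (proj₁ (position (cϵ i)))
    c≋ : ∀ i → (x ◂ c) i ≋ a′ (h i)
    c≋ zero    = ≋-refl
    c≋ (suc i) = proj₂ (position (cϵ i))
    b-image : ∀ i → ⟨ b i , b′ (h i) ⟩ ϵ j₂
    b-image zero    = bz
    b-image (suc i) =
      let w , p , q = joined i
          r = IsFunction.functional E₁.isFunction _ _ _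
                (unϵ (ϵ-respˡ (⟨⟩-cong (c≋ (suc i)) ≋-refl) p)) (unϵ (ay (proj₁ (position (cϵ i)))))
      in ϵ-respˡ (⟨⟩-cong ≋-refl (eq r)) q

    glued : OnePointExtension 𝒜 ℬ c b x
    glued = 𝒜′ , proj₁ (proj₂ pull) , 𝒜≼𝒜′ , elemϵ {enum a′} zero , dom-elim , λ {R} {k} Rk g →
      ⇔-sym (⊨⇔ {ℬ} {ℳ₃} (E₂.preserves R k Rk (b ∘ g) (b′ ∘ h ∘ g) (λ i → unϵ (b-image (g i)))))
      ⇔-∘ (holds R k Rk (h ∘ g) ⇔-∘ ⊨-cong 𝒜′ R (λ i → c≋ (g i)))

  abstract
    -- 𝒜 is amalgamated with ℬ over {cᵢ}, the embedding of the latter into ℬ being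
    -- provided by homogeneity.
    extend : ∀ {n} → Homogeneous n →
      ∀ {𝒜 ℬ} → K (code 𝒜) → K (code ℬ) →
      {c : Fin n → 𝕍} → (∀ i → c i ϵ dom 𝒜) → Distinct c →
      {b : Fin (suc n) → 𝕍} → (∀ i → b i ϵ dom ℬ) → Distinct b →
      ∀ {x} → V x → ¬ x ϵ dom 𝒜 → OnePointExtension 𝒜 ℬ c b x
    extend {n} hom {𝒜} {ℬ} K𝒜 Kℬ {c} cϵ dc {b} bϵ db {x} Vx x∉ =
      glue (SAP ℳ₀ 𝒜 ℬ (pairs c c) (pairs c (b ∘ suc)) (proj₁ (proj₂ base)) K𝒜 Kℬ
        (V-finite _ (λ i → V-⟨⟩ (Vc i) (Vc i)))
        (pairs-embedding matching-refl ≋-refl cϵ (proj₂ (proj₂ base)))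
        (V-finite _ (λ i → V-⟨⟩ (Vc i) (V-elem (V-fst (K⊆V Kℬ)) (bϵ (suc i)))))
        (pairs-embedding (distinct-matching dc dsuc) ≋-refl (bϵ ∘ suc)
          λ R k Rk g → mk⇔ (hom R k Rk g K𝒜 Kℬ cϵ (bϵ ∘ suc) dc dsuc)
                           (hom R k Rk g Kℬ K𝒜 (bϵ ∘ suc) cϵ dsuc dc)
                       ⇔-∘ proj₂ (proj₂ base) R k Rk g))
      where
      Vc : ∀ i → V (c i)
      Vc i = V-elem (V-fst (K⊆V K𝒜)) (cϵ i)
      base : Pullback 𝒜 c c
      base = K-pullback {𝒜} K𝒜 Vc cϵ matching-refl
      ℳ₀ : Structure
      ℳ₀ = structure (enum c) (proj₁ base)
      dsuc : Distinct (b ∘ suc)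
      dsuc i j e = Fin.suc-injective (db (suc i) (suc j) e)
      c→b : ∀ {i w} → ⟨ c i , w ⟩ ϵ pairs c (b ∘ suc) → w ≋ b (suc i)
      c→b {i} {w} m = let l , p , q = pairs-elim m in
        subst (λ l → w ≋ b (suc l)) (sym (dc i l p)) q
      glue : ∃[ ℳ₃ ] ∃[ j₁ ] ∃[ j₂ ] (K (code ℳ₃)
               × V j₁ × Embedding L 𝒜 ℳ₃ j₁ × V j₂ × Embedding L ℬ ℳ₃ j₂
               × (∀ u w → (pairs c c then j₁ ∶ u ↦ w) ⇔ (pairs c (b ∘ suc) then j₂ ∶ u ↦ w))
               × (∀ w → (w ∈Im j₁ × w ∈Im j₂) ⇔ (∃[ u ] (pairs c c then j₁ ∶ u ↦ w)))) →
             OnePointExtension 𝒜 ℬ c b x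
      glue (ℳ₃ , j₁ , j₂ , Kℳ₃ , _ , E₁ , _ , E₂ , commute , strong) =
        Glue.glued {𝒜 = 𝒜} {ℬ} {ℳ₃} K𝒜 Kℳ₃ (proj₂ (proj₂ (K-finite {𝒜} K𝒜)))
          E₁ E₂ cϵ bϵ joined new Vx x∉
        where
        joined : ∀ i → ∃[ w ] (⟨ c i , w ⟩ ϵ j₁ × ⟨ b (suc i) , w ⟩ ϵ j₂)
        joined i =
          let w , cw = IsFunction.total (Embedding.isFunction E₁) (c i) (unϵ (cϵ i))
              v , cv , vw = to (commute (c i) w) (c i , unϵ (pairs-intro c c i) , cw)
          in w , el cw , ϵ-respˡ (⟨⟩-cong (c→b (el cv)) ≋-refl) (el vw)
        -- The use of strong amalgamation: a value common to both images comes from the base, which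
        -- would make `b zero` equal to some `b (suc l)`.
        new : ∀ u {w} → ⟨ u , w ⟩ ϵ j₁ → ¬ ⟨ b zero , w ⟩ ϵ j₂
        new u {w} p q =
          let v , common = to (strong w) ((u , unϵ p) , b zero , unϵ q)
              s , vs , sw = to (commute v w) common
              l , _ , s≋ = pairs-elim {a = c} {b ∘ suc} (el vs)
          in Fin.0≢1+n (db zero (suc l)
               (≋-trans (eq (Embedding.injective E₂ _ _ _ (unϵ q) sw)) s≋))

-- A literal of minimal arity

Verdict : Bool → Set₁ → Set₁
Verdict true  P = P
Verdict false P = ¬ P

module _ (em : ExcludedMiddle (lsuc 0ℓ)) where

  least : (P : ℕ → Set₁) → ∀ n → P n → ∃[ m ] (P m × (∀ k → k < m → ¬ P k))
  least P = <-rec _ go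
    where
    go : ∀ n → (∀ {k} → k < n → P k → ∃[ m ] (P m × (∀ k → k < m → ¬ P k))) →
         P n → ∃[ m ] (P m × (∀ k → k < m → ¬ P k))
    go n rec p with em {∃[ k ] (k < n × P k)}
    ... | yes (k , k<n , q) = rec k<n q
    ... | no none = n , p , λ k k<n q → none (k , k<n , q)

  module Nontrivial {V : Class} (M : IsTransitiveModel V) {L : 𝕍} (VL : V L)
    {K : Class} (isClass : IsClassOf V K) (SF : StrongFraïssé V L K) where

    open FraïsséClass em M VL isClass SF
    open StrongFraïssé SF

    -- The variables of ψ need not all occur, so that minimality of n applies to
    -- all atomic formulas in fewer variables.
    Undecided : ℕ → Set₁
    Undecided n = Σ[ ψ ∈ Literal L n ] (¬ HoldsOnDistinct K ψ × ¬ HoldsOnDistinct K (neg ψ))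

    undecided : ¬ Trivial L K → ∃[ n ] Undecided n
    undecided nt = by-contradiction λ none → nt λ n ψ _ → decide n ψ none
      where
      decide : ∀ n ψ → ¬ (∃[ n ] Undecided n) → HoldsOnDistinct K ψ ⊎ HoldsOnDistinct K (neg ψ)
      decide n ψ none with em {HoldsOnDistinct K ψ} | em {HoldsOnDistinct K (neg ψ)}
      ... | yes p | _     = inj₁ p
      ... | no _  | yes q = inj₂ q
      ... | no p  | no q  = ⊥-elim (none (n , ψ , p , q))

    decided⇒homogeneous : ∀ {n} → ¬ Undecided n → Homogeneous n
    decided⇒homogeneous ¬u R k Rk f {𝒜} {ℬ} K𝒜 Kℬ {a} {b} aϵ bϵ da db h =
      by-contradiction λ ¬h → ¬u (atom (relA R k Rk f)
        , (λ always → ¬h (el (always ℬ Kℬ b (unϵ ∘ bϵ) λ i j e → db i j (eq e))))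
        , (λ never → never 𝒜 K𝒜 a (unϵ ∘ aϵ) (λ i j e → da i j (eq e)) (unϵ h)))

    -- Negation only swaps the two failures, and an equality is always decided on distinct tuples,
    -- so a relational atom remains.
    undecided-atom : ∀ {n} (ψ : Literal L n) →
      ¬ HoldsOnDistinct K ψ → ¬ HoldsOnDistinct K (neg ψ) →
      Σ[ R ∈ 𝕍 ] Σ[ k ∈ ℕ ] Σ[ Rk ∈ ⟨ R , nat k ⟩ ∈ L ]
      Σ[ f ∈ (Fin k → Fin n) ] (¬ HoldsOnDistinct K (atom (relA R k Rk f))
                              × ¬ HoldsOnDistinct K (neg (atom (relA R k Rk f))))
    undecided-atom (neg ψ) p q =
      undecided-atom ψ (λ h → q λ 𝒜 k a aϵ da n → n (h 𝒜 k a aϵ da)) p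
    undecided-atom (atom (relA R k Rk f)) p q = R , k , Rk , f , p , q
    undecided-atom (atom (eqA i j)) p q with i Fin.≟ j
    ... | yes refl = ⊥-elim (p λ 𝒜 _ a _ _ → ≈-refl (a i))
    ... | no i≢j   = ⊥-elim (q λ 𝒜 _ a _ da e → i≢j (da i j e))

    Witness : ∀ {n} (R : 𝕍) {k} → (Fin k → Fin n) → Bool → Set₁
    Witness {n} R f β = ∃[ 𝒜 ] (K (code 𝒜) × Σ[ a ∈ (Fin n → 𝕍) ]
      ((∀ i → a i ϵ dom 𝒜) × Distinct a × Verdict β (𝒜 ⊨ R · (a ∘ f))))

    -- Homogeneity is used at two sizes: at 0 to add a point freely, and at `m` to add a point with
    -- a prescribed truth value.
    record Splitting (m : ℕ) : Set₁ where
      field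
        homogeneous : ∀ {n} → n ≤ m → Homogeneous n
        R           : 𝕍
        k           : ℕ
        Rk          : ⟨ R , nat k ⟩ ∈ L
        f           : Fin k → Fin (suc m)
        witness     : ∀ β → Witness R f β

    -- JEP excludes n = 0: the two witnesses would embed in a common structure.
    splitting : ¬ Trivial L K → ∃[ m ] Splitting m
    splitting nt = split (least Undecided _ (proj₂ (undecided nt)))
      where
      split : ∃[ n ] (Undecided n × (∀ j → j < n → ¬ Undecided j)) → ∃[ m ] Splitting m
      split (n , (ψ , p₀ , q₀) , minimal) with undecided-atom ψ p₀ q₀
      ... | R , k , Rk , f , p , q = positive n f minimal (witness true) (witness false)
        where
        witness : ∀ β → Witness R f β
        witness true = by-contradiction λ none → q λ 𝒜 K𝒜 a aϵ da h →
          none (𝒜 , K𝒜 , a , el ∘ aϵ , (λ i j e → da i j (un≋ e)) , el h)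
        witness false = by-contradiction λ none → p λ 𝒜 K𝒜 a aϵ da →
          unϵ (by-contradiction λ h →
            none (𝒜 , K𝒜 , a , el ∘ aϵ , (λ i j e → da i j (un≋ e)) , h))
        positive : ∀ n (f : Fin k → Fin n) → (∀ j → j < n → ¬ Undecided j) →
          Witness R f true → Witness R f false → ∃[ m ] Splitting m
        positive zero f _ (𝒜 , K𝒜 , a , _ , _ , yes-R) (ℬ , Kℬ , b , _ , _ , no-R)
          with JEP 𝒜 ℬ K𝒜 Kℬ
        ... | 𝒞 , _ , (g , _ , E) , (g′ , _ , E′) = ⊥-elim (no-R (el
          (from (Embedding.preserves E′ R k Rk (b ∘ f) (a ∘ f) λ i → ⊥-elim (Fin.¬Fin0 (f i)))
            (to (Embedding.preserves E R k Rk (a ∘ f) (a ∘ f) λ i → ⊥-elim (Fin.¬Fin0 (f i)))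
              (unϵ yes-R)))))
        positive (suc m) f min w₁ w₀ = m , record
          { homogeneous = λ n≤m → decided⇒homogeneous (min _ (s≤s n≤m))
          ; R = R ; k = k ; Rk = Rk ; f = f
          ; witness = λ { true → w₁ ; false → w₀ } }

-- Density

bit : Bool → 𝕍
bit false = nat 0
bit true  = nat 1

verdict-unique : ∀ {P} β γ → Verdict β P → Verdict γ P → β ≡ γ
verdict-unique false false _ _ = refl
verdict-unique false true  n p = ⊥-elim (n p)
verdict-unique true  false p n = ⊥-elim (n p)
verdict-unique true  true  _ _ = refl

verdict-map : ∀ {P Q} β → P ⇔ Q → Verdict β P → Verdict β Q
verdict-map false h n = n ∘ from h
verdict-map true  h p = to h p

bit-cong : ∀ {β γ} → β ≡ γ → bit β ≋ bit γ
bit-cong refl = ≋-refl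

module CohenGeneric (em : ExcludedMiddle (lsuc 0ℓ)) {V : Class} (M : IsTransitiveModel V)
  {X : 𝕍} (VX : V X) {L : 𝕍} (VL : V L)
  {K : Class} (isClass : IsClassOf V K) (SF : StrongFraïssé V L K)
  {m} (split : Nontrivial.Splitting em M VL isClass SF m)
  {c : Fin m → 𝕍} (cϵX : ∀ i → c i ϵ X) (dc : Distinct c) where

  open Model M
  open Language M VL
  open FraïsséClass em M VL isClass SF
  open Nontrivial.Splitting split

  decide : ∀ P → Σ[ β ∈ Bool ] Verdict β P
  decide P with em {P}
  ... | yes p = true , p
  ... | no ¬p = false , ¬p

  finite-subset : ∀ {n} (v : Fin n → 𝕍) {q} → (∀ {e} → e ϵ q → e ϵ enum v) → Finite q
  finite-subset {n} v {q} sub with em {∃[ e ] e ϵ q}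
  ... | no empty = 0 , (λ ()) , un≋ (≋-ext {q} {enum λ ()}
      (λ m → ⊥-elim (empty (_ , m))) λ { (el (() , _)) })
  ... | yes (e₀ , e₀ϵ) = n , w , un≋ (≋-ext {q} {enum w}
      (λ m → let i , p = index (sub m) in
         memb {enum w} i (≋-trans p (≋-sym (proj₂ (proj₂ (pick i)) (ϵ-respˡ p m)))))
      λ { (el (i , p)) → ϵ-respˡ (≋-sym (eq p)) (proj₁ (proj₂ (pick i))) })
    where
    -- Indices whose value falls outside `q` are redirected to the default `e₀`; the empty `q`,
    -- having no default, was treated apart.
    pick : ∀ i → ∃[ w ] (w ϵ q × (v i ϵ q → w ≋ v i))
    pick i with em {v i ϵ q}
    ... | yes p = v i , p , λ _ → ≋-refl
    ... | no ¬p = e₀ , e₀ϵ , λ p → ⊥-elim (¬p p)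
    w : Fin n → 𝕍
    w i = proj₁ (pick i)

  Condition : Structure → Set₁
  Condition 𝒜 = K (code 𝒜) × (∀ {z} → z ϵ dom 𝒜 → z ϵ X)

  Atom : Structure → 𝕍 → Set₁
  Atom 𝒜 x = 𝒜 ⊨ R · ((x ◂ c) ∘ f)

  Base : Structure → Set₁
  Base 𝒜 = ∀ i → c i ϵ dom 𝒜

  -- e belongs to the finite partial function on dom 𝒜 read off from 𝒜.
  Entry : Structure → 𝕍 → Set₁
  Entry 𝒜 e = ∃[ x ] (x ϵ dom 𝒜 × Σ[ β ∈ Bool ] (e ≋ ⟨ x , bit β ⟩ × Verdict β (Atom 𝒜 x)))

  -- `Base` is included because the truth value of the atom is preserved in stronger conditions only
  -- once all `c i` lie in the domain.
  Agrees : 𝕍 → Structure → Set₁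
  Agrees q 𝒜 = Base 𝒜 × (∀ e → e ϵ q → Entry 𝒜 e)

  Atom-cong : ∀ 𝒜 {x y} → x ≋ y → Atom 𝒜 x ⇔ Atom 𝒜 y
  Atom-cong 𝒜 {x} {y} e = ⊨-cong 𝒜 R (λ i → at (f i))
    where
    at : ∀ i → (x ◂ c) i ≋ (y ◂ c) i
    at zero    = e
    at (suc i) = ≋-refl

  ◂-in : ∀ {x z} → x ϵ z → (∀ i → c i ϵ z) → ∀ i → (x ◂ c) i ϵ z
  ◂-in xϵ cϵ zero    = xϵ
  ◂-in xϵ cϵ (suc i) = cϵ i

  Entry-mono : ∀ {𝒜 ℬ} → Base 𝒜 → 𝒜 ≼ ℬ → ∀ {e} → Entry 𝒜 e → Entry ℬ e
  Entry-mono base p (x , xϵ , β , q , v) =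
    x , sub p xϵ , β , q , verdict-map β (same p Rk (◂-in xϵ base ∘ f)) v

  Entry-cong : ∀ {𝒜 e e′} → e ≋ e′ → Entry 𝒜 e → Entry 𝒜 e′
  Entry-cong p (x , xϵ , β , q , v) = x , xϵ , β , ≋-trans (≋-sym p) q , v

  Entry-functional : ∀ {𝒜 x y z} → Entry 𝒜 ⟨ x , y ⟩ → Entry 𝒜 ⟨ x , z ⟩ → y ≋ z
  Entry-functional {𝒜} (x₁ , _ , β , p , v) (x₂ , _ , γ , q , w) =
    ≋-trans (⟨⟩-injʳ p) (≋-trans (bit-cong (verdict-unique β γ
      (verdict-map β (Atom-cong 𝒜 (≋-trans (≋-sym (⟨⟩-injˡ p)) (⟨⟩-injˡ q))) v) w))
      (≋-sym (⟨⟩-injʳ q)))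

  Agrees-mono : ∀ {q 𝒜 ℬ} → 𝒜 ≼ ℬ → Agrees q 𝒜 → Agrees q ℬ
  Agrees-mono p (base , h) = sub p ∘ base , λ e eϵ → Entry-mono base p (h e eϵ)

  Agrees-⊆ : ∀ {q q′ 𝒜} → (∀ {e} → e ϵ q′ → e ϵ q) → Agrees q 𝒜 → Agrees q′ 𝒜
  Agrees-⊆ s (base , h) = base , λ e eϵ → h e (s eϵ)

  abstract
    -- This `q` is h(𝒜). Its totality on `dom 𝒜` prevents a Cohen condition extending it from
    -- contradicting `𝒜`.
    reading : ∀ {𝒜} → Condition 𝒜 → Base 𝒜 → ∃[ q ] (V q × Agrees q 𝒜
      × (∀ x → x ϵ dom 𝒜 → ∃[ y ] ⟨ x , y ⟩ ϵ q) × (∀ {q′} → Agrees q′ 𝒜 → Finite q′))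
    reading {𝒜} (K𝒜 , inX) base = enum v , V-finite v (λ i → V-⟨⟩ (Va i) (V-bit (β i)))
      , (base , λ { e (el (i , p)) → a i , aϵ i , β i , eq p , proj₂ (decide _) })
      , (λ x xϵ → let i , p = index (ϵ-respʳ dom𝒜 xϵ) in
           bit (β i) , memb {enum v} i (⟨⟩-cong p ≋-refl))
      , λ (_ , h) → finite-subset v λ eϵ → covered (h _ eϵ)
      where
      n : ℕ
      n = proj₁ (K-finite {𝒜} K𝒜)
      a : Fin n → 𝕍
      a = proj₁ (proj₂ (K-finite {𝒜} K𝒜))
      dom𝒜 : dom 𝒜 ≋ enum a
      dom𝒜 = proj₂ (proj₂ (K-finite {𝒜} K𝒜))
      aϵ : ∀ i → a i ϵ dom 𝒜
      aϵ i = ϵ-respʳ (≋-sym dom𝒜) (elemϵ {enum a} i)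
      Va : ∀ i → V (a i)
      Va i = V-elem VX (inX (aϵ i))
      V-bit : ∀ β → V (bit β)
      V-bit false = V-nat 0
      V-bit true  = V-nat 1
      β : Fin n → Bool
      β i = proj₁ (decide (Atom 𝒜 (a i)))
      v : Fin n → 𝕍
      v i = ⟨ a i , bit (β i) ⟩
      covered : ∀ {e} → Entry 𝒜 e → e ϵ enum v
      covered {e} (x , xϵ , γ , p , w) =
        let i , q = index (ϵ-respʳ dom𝒜 xϵ) in
        memb {enum v} i (≋-trans p (⟨⟩-cong q
          (bit-cong (verdict-unique γ (β i) (verdict-map γ (Atom-cong 𝒜 q) w) (proj₂ (decide _))))))

  Cohen-condition : ∀ {q 𝒜} → Condition 𝒜 → Agrees q 𝒜 → Forcing.Cond (Cohen X) q
  Cohen-condition {q} {𝒜} C𝒜 ag@(base , h) =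
    proj₂ (proj₂ (proj₂ (proj₂ (reading C𝒜 base)))) ag
    , (λ e e∈ → entry (h e (el e∈)))
    , λ x y z p q → un≋ (Entry-functional {𝒜} (h _ (el p)) (h _ (el q)))
    where
    entry : ∀ {e} → Entry 𝒜 e → ∃[ x ] (x ∈ X × (e ≈ ⟨ x , nat 0 ⟩ ⊎ e ≈ ⟨ x , nat 1 ⟩))
    entry (x , xϵ , false , p , _) = x , unϵ (proj₂ C𝒜 xϵ) , inj₁ (un≋ p)
    entry (x , xϵ , true  , p , _) = x , unϵ (proj₂ C𝒜 xϵ) , inj₂ (un≋ p)

  Extension : Structure → (Structure → Set₁) → Set₁
  Extension 𝒜 P = ∃[ 𝒜′ ] (Condition 𝒜′ × 𝒜 ≼ 𝒜′ × P 𝒜′)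

  within : ∀ {𝒜 𝒜′ x} → Condition 𝒜 → x ϵ X → K (code 𝒜′) →
    (∀ {z} → z ϵ dom 𝒜′ → z ϵ dom 𝒜 ⊎ z ≋ x) → Condition 𝒜′
  within (_ , inX) xϵ K𝒜′ h = K𝒜′ , λ z → [ inX , (λ e → ϵ-respˡ (≋-sym e) xϵ) ]′ (h z)

  add-point : ∀ {𝒜} → Condition 𝒜 → ∀ {x} → x ϵ X → Extension 𝒜 (λ 𝒜′ → x ϵ dom 𝒜′)
  add-point {𝒜} C𝒜 {x} xϵX with em {x ϵ dom 𝒜}
  ... | yes xϵ = 𝒜 , C𝒜 , ≼-refl , xϵ
  -- Either witness would do: it only supplies a nonempty member of `K`, to be amalgamated with `𝒜`
  -- over the empty tuple.
  ... | no x∉ with witness true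
  ...   | ℬ , Kℬ , b , bϵ , _ , _
    with extend (homogeneous z≤n) {𝒜} {ℬ} (proj₁ C𝒜) Kℬ {λ ()} (λ ()) (λ ())
           {λ _ → b zero} (λ _ → bϵ zero) (λ { zero zero _ → refl }) (V-elem VX xϵX) x∉
  ...     | 𝒜′ , K𝒜′ , p , xϵ , h , _ = 𝒜′ , within {𝒜} C𝒜 xϵX K𝒜′ h , p , xϵ

  add-points : ∀ {n} (v : Fin n → 𝕍) → (∀ i → v i ϵ X) → ∀ {𝒜} → Condition 𝒜 →
    Extension 𝒜 (λ 𝒜′ → ∀ i → v i ϵ dom 𝒜′)
  add-points {zero}  v vϵ {𝒜} C𝒜 = 𝒜 , C𝒜 , ≼-refl , λ ()
  add-points {suc n} v vϵ C𝒜 with add-point C𝒜 (vϵ zero)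
  ... | 𝒜₁ , C₁ , p₁ , z₁ with add-points (v ∘ suc) (vϵ ∘ suc) C₁
  ...   | 𝒜₂ , C₂ , p₂ , z₂ = 𝒜₂ , C₂ , ≼-trans p₁ p₂
    , λ { zero → sub p₂ z₁ ; (suc i) → z₂ i }

  decide-point : ∀ {𝒜} → Condition 𝒜 → Base 𝒜 → ∀ {x} → x ϵ X → ¬ x ϵ dom 𝒜 → ∀ β →
    Extension 𝒜 (λ 𝒜′ → x ϵ dom 𝒜′ × (∀ {z} → z ϵ dom 𝒜′ → z ϵ dom 𝒜 ⊎ z ≋ x)
                       × Verdict β (Atom 𝒜′ x))
  decide-point {𝒜} C𝒜 base {x} xϵX x∉ β with witness β
  ... | ℬ , Kℬ , b , bϵ , db , v
    with extend (homogeneous (≤-refl)) {𝒜} {ℬ} (proj₁ C𝒜) Kℬ base dc bϵ db (V-elem VX xϵX) x∉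
  ...   | 𝒜′ , K𝒜′ , p , xϵ , h , t =
    𝒜′ , within {𝒜} C𝒜 xϵX K𝒜′ h , p , xϵ , h , verdict-map β (⇔-sym (t Rk f)) v

  Compatible : 𝕍 → Structure → Set₁
  Compatible d 𝒜 = ∀ {x y} → ⟨ x , y ⟩ ϵ d → x ϵ dom 𝒜 → Entry 𝒜 ⟨ x , y ⟩

  module _ {d : 𝕍} (Cd : Forcing.Cond (Cohen X) d) where

    parse : ∀ {e} → e ϵ d → ∃[ x ] (x ϵ X × Σ[ β ∈ Bool ] e ≋ ⟨ x , bit β ⟩)
    parse (el e∈) with proj₁ (proj₂ Cd) _ e∈
    ... | x , x∈ , inj₁ p = x , el x∈ , false , eq p
    ... | x , x∈ , inj₂ p = x , el x∈ , true , eq p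

    force-entry : ∀ {𝒜 e} → Condition 𝒜 → Base 𝒜 → Compatible d 𝒜 → e ϵ d →
      Extension 𝒜 (λ 𝒜′ → Compatible d 𝒜′ × Entry 𝒜′ e)
    force-entry {𝒜} {e} C𝒜 base comp eϵ with parse eϵ
    ... | x , xϵX , β , p with em {x ϵ dom 𝒜}
    ...   | yes xϵ = 𝒜 , C𝒜 , ≼-refl , comp
      , Entry-cong {𝒜} (≋-sym p) (comp (ϵ-respˡ p eϵ) xϵ)
    ...   | no x∉ with decide-point C𝒜 base xϵX x∉ β
    ...     | 𝒜′ , C𝒜′ , s , xϵ , h , v = 𝒜′ , C𝒜′ , s , comp′ , x , xϵ , β , p , v
      where
      -- The domain has grown by `x` alone, where `d` is single-valued, so compatibility survives
      -- for the remaining entries.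
      comp′ : Compatible d 𝒜′
      comp′ {y} {z} yzϵ yϵ with h yϵ
      ... | inj₁ old = Entry-mono base s (comp yzϵ old)
      ... | inj₂ new = x , xϵ , β , ⟨⟩-cong new (eq (proj₂ (proj₂ Cd) _ _ _
              (unϵ yzϵ) (unϵ (ϵ-respˡ (≋-trans p (⟨⟩-cong (≋-sym new) ≋-refl)) eϵ)))) , v

    force-entries : ∀ {n} (v : Fin n → 𝕍) → (∀ i → v i ϵ d) →
      ∀ {𝒜} → Condition 𝒜 → Base 𝒜 → Compatible d 𝒜 → Extension 𝒜 (λ 𝒜′ → ∀ i → Entry 𝒜′ (v i))
    force-entries {zero}  v vϵ {𝒜} C𝒜 base comp = 𝒜 , C𝒜 , ≼-refl , λ ()
    force-entries {suc n} v vϵ C𝒜 base comp with force-entry C𝒜 base comp (vϵ zero)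
    ... | 𝒜₁ , C₁ , p₁ , comp₁ , e₁ with force-entries (v ∘ suc) (vϵ ∘ suc) C₁ (sub p₁ ∘ base) comp₁
    ...   | 𝒜₂ , C₂ , p₂ , e₂ = 𝒜₂ , C₂ , ≼-trans p₁ p₂
      , λ { zero → Entry-mono (sub p₁ ∘ base) p₂ e₁ ; (suc i) → e₂ i }

    force : ∀ {𝒜} → Condition 𝒜 → Base 𝒜 → Compatible d 𝒜 → Extension 𝒜 (Agrees d)
    force C𝒜 base comp with proj₁ Cd
    ... | n , v , p with force-entries v
           (λ i → ϵ-respʳ {y = enum v} (≋-sym (eq p)) (elemϵ {enum v} i)) C𝒜 base comp
    ...   | 𝒜′ , C𝒜′ , s , h = 𝒜′ , C𝒜′ , s , sub s ∘ base , λ e eϵ →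
      let i , q = index (ϵ-respʳ {z = enum v} (eq p) eϵ) in Entry-cong {𝒜′} (≋-sym q) (h i)

  force-dense : ∀ {D} → Dense (Cohen X) D → ∀ {𝒜} → Condition 𝒜 →
    Extension 𝒜 (λ 𝒜′ → ∃[ d ] (d ϵ D × Agrees d 𝒜′))
  force-dense (conds , dense) C𝒜 with add-points c cϵX C𝒜
  ... | 𝒜₁ , C₁ , p₁ , base with reading C₁ base
  ...   | q , _ , ag , total , _ with dense q (Cohen-condition C₁ ag)
  ...     | d , d∈ , q⊆d with force (conds d d∈) C₁ base
              (λ {x} {y} xyϵ xϵ → let z , xzϵ = total x xϵ in
                Entry-cong {𝒜₁} (⟨⟩-cong ≋-refl (eq (proj₂ (proj₂ (conds d d∈)) _ _ _
                  (q⊆d _ (unϵ xzϵ)) (unϵ xyϵ)))) (proj₂ ag _ xzϵ))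
  ...       | 𝒜₂ , C₂ , p₂ , ag₂ = 𝒜₂ , C₂ , ≼-trans p₁ p₂ , d , el d∈ , ag₂

  force-base : ∀ {𝒜} → Condition 𝒜 → Extension 𝒜 (Agrees ∅)
  force-base C𝒜 with add-points c cϵX C𝒜
  ... | 𝒜′ , C𝒜′ , p , base = 𝒜′ , C𝒜′ , p , base , λ e eϵ → ⊥-elim (∉∅ eϵ)

-- Definability of the reading

module Extract (em : ExcludedMiddle (lsuc 0ℓ)) {V : Class} (M : IsTransitiveModel V)
  {X : 𝕍} (VX : V X) {L : 𝕍} (VL : V L)
  {K : Class} (isClass : IsClassOf V K) (SF : StrongFraïssé V L K)
  {m} (split : Nontrivial.Splitting em M VL isClass SF m)
  {c : Fin m → 𝕍} (cϵX : ∀ i → c i ϵ X) (dc : Distinct c) where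

  open Model M
  open Language M VL
  open FraïsséClass em M VL isClass SF
  open Nontrivial.Splitting split
  open CohenGeneric em M VX VL isClass SF split cϵX dc

  abstract
    -- `K` may be a proper class, but a structure on a subset of `X` is bounded by the power sets of
    -- `X` and of the atoms over `X`. The bound may be too large, so `agreesᶠ` tests again that the
    -- domain is contained in `X`.
    condition-set : ∃[ P ] (V P × (∀ {p} → p ϵ P → K p) × (∀ {𝒜} → Condition 𝒜 → code 𝒜 ϵ P))
    condition-set =
      let _ , VD , inD = power-bound VX
          _ , VB , inB = atom-bound VX
          _ , VE , inE = power-bound VB
          _ , VQ , inQ = product-bound VD VE
          _ , n , φ , ρ , Vρ , h = isClass
          P , VP , hP = IsTransitiveModel.zfc M .ZFC.separation φ ρ Vρ _ VQ
      in P , VP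
        , (λ {p} pϵ → let Vp = V-elem VP pϵ in from (h p Vp) (proj₂ (to (hP p Vp) (unϵ pϵ))))
        , λ {𝒜} (K𝒜 , inX) → let Vp = K⊆V K𝒜 in el (from (hP (code 𝒜) Vp)
            ( unϵ (inQ (inD (V-fst Vp) inX) (inE (V-snd Vp) λ {e} eϵ →
                let S , j , v , Sj , vϵ , p = K-structure {𝒜} K𝒜 e (unϵ eϵ) in
                ϵ-respˡ (≋-sym (eq p)) (inB S j Sj v (λ i → inX (el (vϵ i))))))
            , to (h (code 𝒜) Vp) K𝒜 ))

  -- The map from a point to its atom as a set of the model.

  atomAt : 𝕍 → 𝕍
  atomAt x = ⟨ R , tuple ((x ◂ c) ∘ f) ⟩

  -- The empty cell marks the position of the variable x.
  cell : Fin (suc m) → 𝕍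
  cell zero    = ∅
  cell (suc i) = ｛ c i , c i ｝

  -- A parameter carrying `f` and the points `c i`, so that one fixed formula describes the tuple
  -- for all `k` and `m`.
  template : 𝕍
  template = tuple (cell ∘ f)

  -- A cell holding a constant is a singleton, hence never confused with the empty marker, even if
  -- the constant is ∅. The condition `z ≋ z` stands for truth, which `Fm` lacks as a primitive.
  Fills : 𝕍 → 𝕍 → 𝕍 → Set₁
  Fills x y w = y ϵ w ⊎ (y ≋ x × ¬ (∃[ z ] (z ϵ w × z ≋ z)))

  fills-elim : ∀ {x y w} j → w ≋ cell j → Fills x y w → y ≋ (x ◂ c) j
  fills-elim zero    p (inj₁ m)       = ⊥-elim (∉∅ (ϵ-respʳ p m))
  fills-elim zero    p (inj₂ (q , _)) = q
  fills-elim (suc j) p (inj₁ m)       = [ id , id ]′ (｛｝-elim (ϵ-respʳ p m))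
  fills-elim (suc j) p (inj₂ (_ , e)) =
    ⊥-elim (e (c j , ϵ-respʳ (≋-sym p) (｛｝-introˡ ≋-refl) , ≋-refl))

  fills-intro : ∀ {x} j → Fills x ((x ◂ c) j) (cell j)
  fills-intro zero    = inj₂ (≋-refl , λ (_ , m , _) → ∉∅ m)
  fills-intro (suc j) = inj₁ (｛｝-introˡ ≋-refl)

  Match : 𝕍 → 𝕍 → 𝕍 → Set₁
  Match x u v = ∃[ i ] ∃[ y ] (u ≋ ⟨ i , y ⟩ ×
    (∃[ i′ ] ∃[ w ] (v ≋ ⟨ i′ , w ⟩ × i′ ≋ i × Fills x y w)))

  match-elim : ∀ {x u v i} → v ≋ ⟨ nat (toℕ i) , cell (f i) ⟩ → Match x u v →
    u ≋ ⟨ nat (toℕ i) , (x ◂ c) (f i) ⟩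
  match-elim {i = i} p (_ , _ , q , _ , _ , r , s , t) =
    let e = ≋-trans (≋-sym r) p in
    ≋-trans q (⟨⟩-cong (≋-trans (≋-sym s) (⟨⟩-injˡ e)) (fills-elim (f i) (⟨⟩-injʳ e) t))

  match-intro : ∀ {x i u v} → u ≋ ⟨ nat (toℕ i) , (x ◂ c) (f i) ⟩ →
    v ≋ ⟨ nat (toℕ i) , cell (f i) ⟩ → Match x u v
  match-intro {i = i} p q = _ , _ , p , _ , _ , q , ≋-refl , fills-intro (f i)

  Instance : 𝕍 → 𝕍 → Set₁
  Instance x t = (∀ u → u ϵ t → ∃[ v ] (v ϵ template × Match x u v))
               × (∀ v → v ϵ template → ∃[ u ] (u ϵ t × Match x u v))

  instance-elim : ∀ {x t} → Instance x t → t ≋ tuple ((x ◂ c) ∘ f)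
  instance-elim {x} (g , h) = ≋-ext
    (λ {u} uϵ → let v , vϵ , a = g u uϵ ; i , p = index {y = template} vϵ in
       memb i (match-elim {x} {i = i} p a))
    (λ { (el (i , p)) → let u , uϵ , a = h _ (elemϵ {template} i) in
       ϵ-respˡ (≋-trans (match-elim {x} {i = i} ≋-refl a) (≋-sym (eq p))) uϵ })

  instance-intro : ∀ {x} → Instance x (tuple ((x ◂ c) ∘ f))
  instance-intro {x} =
    (λ { u (el (i , p)) → _ , elemϵ {template} i , match-intro {x} {i} (eq p) ≋-refl }) ,
    (λ { v (el (i , p)) → _ , elemϵ {tuple ((x ◂ c) ∘ f)} i , match-intro {x} {i} ≋-refl (eq p) })

  matchᶠ : ∀ {n} → Fin n → Fin n → Fin n → Fm n
  matchᶠ x u v = ∃⟨⟩ u (∃⟨⟩ (suc (suc v)) (1F ≈ᶠ 3F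
    ∧ᶠ (2F ∈ᶠ 0F ∨ᶠ (2F ≈ᶠ suc (suc (suc (suc x))) ∧ᶠ ¬ᶠ ∃∈ 0F (0F ≈ᶠ 0F)))))

  V-◂ : ∀ {x} → V x → ∀ i → V ((x ◂ c) i)
  V-◂ Vx zero    = Vx
  V-◂ Vx (suc i) = V-elem VX (cϵX i)

  V-cell : ∀ j → V (cell j)
  V-cell zero    = V-∅
  V-cell (suc j) = V-｛｝ (V-elem VX (cϵX j)) (V-elem VX (cϵX j))

  V-R : V R
  V-R = V-fst (V-elem VL (el Rk))

  V-atom : ∀ {x} → V x → V (atomAt x)
  V-atom Vx = V-⟨⟩ V-R (V-tuple _ (λ i → V-◂ Vx (f i)))

  -- z = ⟨ x , atomAt x ⟩
  atomᶠ : Fm 4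
  atomᶠ = ∃⟨⟩ 0F (1F ≈ᶠ 3F ∧ᶠ ∃⟨⟩ 0F (1F ≈ᶠ 7F
    ∧ᶠ ∀∈ 0F (∃∈ 7F (matchᶠ 7F 1F 0F)) ∧ᶠ ∀∈ 6F (∃∈ 1F (matchᶠ 7F 0F 1F))))

  abstract
    atoms : ∃[ A ] (V A × (∀ {x s} → ⟨ x , s ⟩ ϵ A → s ≋ atomAt x)
                        × (∀ {x} → x ϵ X → ⟨ x , atomAt x ⟩ ϵ A))
    atoms =
      let A , VA , elim , intro = image atomᶠ {template ∷ R ∷ []}
            (V-tuple _ (V-cell ∘ f) ∷ V-R ∷ []) VX (λ {x} _ → ⟨ x , atomAt x ⟩)
            (λ xϵ → V-⟨⟩ (V-elem VX xϵ) (V-atom (V-elem VX xϵ)))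
            (λ {x} _ → _ , _ , ≋-refl , ≋-refl , _ , _ , ≋-refl , ≋-refl , instance-intro {x})
            λ { {x} _ (_ , _ , p , q , _ , _ , r , s , h) → ≋-trans p
                  (⟨⟩-cong q (≋-trans r (⟨⟩-cong s (instance-elim {x} h)))) }
      in A , VA
        , (λ xs → let y , _ , p = elim xs in ≋-trans (⟨⟩-injʳ p)
             (⟨⟩-cong ≋-refl (tuple-cong λ i → ◂-cong (≋-sym (⟨⟩-injˡ p)) (f i))))
        , λ xϵ → intro xϵ
      where
      ◂-cong : ∀ {x y} → x ≋ y → ∀ i → (x ◂ c) i ≋ (y ◂ c) i
      ◂-cong p zero    = p
      ◂-cong p (suc i) = ≋-refl

  P A : 𝕍
  P = proj₁ condition-set
  A = proj₁ atoms

  -- `Entry` with the atom looked up in the parameter `A`, in the exact form to which the last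
  -- conjunct of `agreesᶠ` unfolds.
  Entryᴬ : 𝕍 → 𝕍 → 𝕍 → Set₁
  Entryᴬ d r e = ∃[ x ] ∃[ i ] (e ≋ ⟨ x , i ⟩ × x ϵ d × (∃[ s ] (V s × ⟨ x , s ⟩ ϵ A
    × ((i ≋ nat 1 × s ϵ r) ⊎ (i ≋ nat 0 × ¬ s ϵ r)))))

  Entryᴬ⇒Entry : ∀ {d r e} → Entryᴬ d r e → Entry (structure d r) e
  Entryᴬ⇒Entry (x , i , p , xϵ , s , _ , xs , inj₁ (q , h)) =
    x , xϵ , true , ≋-trans p (⟨⟩-cong ≋-refl q) , ϵ-respˡ (proj₁ (proj₂ (proj₂ atoms)) xs) h
  Entryᴬ⇒Entry (x , i , p , xϵ , s , _ , xs , inj₂ (q , h)) =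
    x , xϵ , false , ≋-trans p (⟨⟩-cong ≋-refl q)
    , λ h′ → h (ϵ-respˡ (≋-sym (proj₁ (proj₂ (proj₂ atoms)) xs)) h′)

  Entry⇒Entryᴬ : ∀ {𝒜 e} → (∀ {x} → x ϵ dom 𝒜 → x ϵ X) → Entry 𝒜 e → Entryᴬ (dom 𝒜) (rel 𝒜) e
  Entry⇒Entryᴬ inX (x , xϵ , β , p , v) =
    x , bit β , p , xϵ , atomAt x , V-atom (V-elem VX (inX xϵ))
    , proj₂ (proj₂ (proj₂ atoms)) (inX xϵ) , verdict β v
    where
    verdict : ∀ β {Q} → Verdict β Q → (bit β ≋ nat 1 × Q) ⊎ (bit β ≋ nat 0 × ¬ Q)
    verdict true  v = inj₁ (≋-refl , v)
    verdict false v = inj₂ (≋-refl , v)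

  -- s = ⟨ q , p ⟩ for some p in P coding a condition 𝒜 with which q agrees
  agreesᶠ : Fm 7
  agreesᶠ = ∃⟨⟩ 0F (0F ∈ᶠ 3F ∧ᶠ ∃⟨⟩ 0F
    ( ∀∈ 6F (0F ∈ᶠ 2F)
    ∧ᶠ ∀∈ 1F (0F ∈ᶠ 8F)
    ∧ᶠ ∀∈ 3F (∃⟨⟩ 0F (1F ∈ᶠ 4F ∧ᶠ ∃V (⟪ 2F , 0F ⟫∈ᶠ # 12
         ∧ᶠ ((1F ≈ᶠ # 13 ∧ᶠ 0F ∈ᶠ 4F) ∨ᶠ (1F ≈ᶠ # 14 ∧ᶠ ¬ᶠ 0F ∈ᶠ 4F)))))))

  record Agreement (q p : 𝕍) : Set₁ where
    field
      𝒜         : Structure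
      is-code   : p ≋ code 𝒜
      condition : Condition 𝒜
      agrees    : Agrees q 𝒜

  abstract
    agreement-set : ∃[ ℛ ] (V ℛ
      × (∀ {s} → s ϵ ℛ → ∃[ q ] ∃[ p ] (s ≋ ⟨ q , p ⟩ × Agreement q p))
      × (∀ {q 𝒜} → V q → Condition 𝒜 → Agrees q 𝒜 → ⟨ q , code 𝒜 ⟩ ϵ ℛ))
    agreement-set =
      let _ , VX2 , inX2 = product-bound VX (V-｛｝ (V-nat 0) (V-nat 1))
          _ , VQ , inQ = power-bound VX2
          _ , VW , inW = product-bound VQ (proj₁ (proj₂ condition-set))
          ℛ , Vℛ , elim , intro = separate agreesᶠ
            {P ∷ enum c ∷ X ∷ A ∷ nat 1 ∷ nat 0 ∷ []}
            (proj₁ (proj₂ condition-set) ∷ V-finite c (V-elem VX ∘ cϵX) ∷ VX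
              ∷ proj₁ (proj₂ atoms) ∷ V-nat 1 ∷ V-nat 0 ∷ []) VW
      in ℛ , Vℛ
        , (λ sϵ → unpack (proj₂ (elim sϵ)))
        , λ {q} {𝒜} Vq C𝒜 ag → intro
            (inW (inQ Vq (λ eϵ → in-bound inX2 C𝒜 (proj₂ ag _ eϵ)))
                 (proj₂ (proj₂ (proj₂ condition-set)) C𝒜))
            ( q , code 𝒜 , ≋-refl , proj₂ (proj₂ (proj₂ condition-set)) C𝒜
            , dom 𝒜 , rel 𝒜 , ≋-refl
            , (λ { z (el (i , p)) → ϵ-respˡ (≋-sym (eq p)) (proj₁ ag i) })
            , (λ z → proj₂ C𝒜)
            , λ e eϵ → Entry⇒Entryᴬ {𝒜} (proj₂ C𝒜) (proj₂ ag e eϵ) )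
      where
      unpack : ∀ {s} → ∃[ q ] ∃[ p ] (s ≋ ⟨ q , p ⟩ × p ϵ P × (∃[ d ] ∃[ r ] (p ≋ ⟨ d , r ⟩
        × (∀ z → z ϵ enum c → z ϵ d) × (∀ z → z ϵ d → z ϵ X)
        × (∀ e → e ϵ q → Entryᴬ d r e)))) → ∃[ q ] ∃[ p ] (s ≋ ⟨ q , p ⟩ × Agreement q p)
      unpack (q , p , e , pϵ , d , r , h , base , inX , ent) = q , p , e , record
        { 𝒜 = structure d r
        ; is-code = h
        ; condition = K-resp h (proj₁ (proj₂ (proj₂ condition-set)) pϵ) , inX _
        ; agrees = (λ i → base _ (elemϵ {enum c} i)) , λ e eϵ → Entryᴬ⇒Entry (ent e eϵ)
        }
      in-bound : ∀ {B 𝒜 e} → (∀ {a b} → a ϵ X → b ϵ ｛ nat 0 , nat 1 ｝ → ⟨ a , b ⟩ ϵ B) →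
        Condition 𝒜 → Entry 𝒜 e → e ϵ B
      in-bound inB C𝒜 (x , xϵ , false , p , _) =
        ϵ-respˡ (≋-sym p) (inB (proj₂ C𝒜 xϵ) (｛｝-introˡ ≋-refl))
      in-bound inB C𝒜 (x , xϵ , true , p , _) =
        ϵ-respˡ (≋-sym p) (inB (proj₂ C𝒜 xϵ) (｛｝-introʳ ≋-refl))

-- The generic extension

module GenericExtension (em : ExcludedMiddle (lsuc 0ℓ)) {V : Class} (M : IsTransitiveModel V)
  {X : 𝕍} (VX : V X) {L : 𝕍} (VL : V L)
  {K : Class} (isClass : IsClassOf V K) (SF : StrongFraïssé V L K)
  {m} (split : Nontrivial.Splitting em M VL isClass SF m)
  {c : Fin m → 𝕍} (cϵX : ∀ i → c i ϵ X) (dc : Distinct c)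
  {G : 𝕍} (gen : Generic V (ℭ L K X) G) where

  open Model M
  open FraïsséClass em M VL isClass SF
  open CohenGeneric em M VX VL isClass SF split cϵX dc
  open Extract em M VX VL isClass SF split cϵX dc
  open Forcing (ℭ L K X) renaming (_≤_ to _⊑_)
  open Generic gen

  code≋⇒≼ : ∀ {𝒜 ℬ} → code 𝒜 ≋ code ℬ → 𝒜 ≼ ℬ
  code≋⇒≼ p = record
    { sub  = ϵ-respʳ (⟨⟩-injˡ p)
    ; same = λ _ _ → mk⇔ (ϵ-respʳ (⟨⟩-injʳ p)) (ϵ-respʳ (≋-sym (⟨⟩-injʳ p))) }

  Cond⇒Condition : ∀ {p} → Cond p → ∃[ 𝒜 ] (p ≋ code 𝒜 × Condition 𝒜)
  Cond⇒Condition (Kp , 𝒜 , p≈ , inX) = 𝒜 , eq p≈ , K-resp (eq p≈) Kp , λ z → el (inX _ (unϵ z))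

  Condition⇒Cond : ∀ {p 𝒜} → p ≋ code 𝒜 → Condition 𝒜 → Cond p
  Condition⇒Cond {𝒜 = 𝒜} e (K𝒜 , inX) = K-resp (≋-sym e) K𝒜 , 𝒜 , un≋ e , λ z z∈ → unϵ (inX (el z∈))

  ⊑⇒≼ : ∀ {p q 𝒜 ℬ} → p ⊑ q → p ≋ code 𝒜 → q ≋ code ℬ → ℬ ≼ 𝒜
  ⊑⇒≼ (𝒜′ , ℬ′ , p≈ , q≈ , s) pe qe = ≼-trans (code≋⇒≼ (≋-trans (≋-sym qe) (eq q≈)))
    (≼-trans (Substructure⇒≼ s) (code≋⇒≼ (≋-trans (≋-sym (eq p≈)) pe)))

  p₀ : 𝕍
  p₀ = proj₁ nonempty
  p₀ϵG : p₀ ϵ G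
  p₀ϵG = el (proj₂ nonempty)
  Cond-p₀ : Cond p₀
  Cond-p₀ = conditions p₀ (proj₂ nonempty)

  open Check p₀
  open Names G

  ℛ : 𝕍
  ℛ = proj₁ agreement-set
  Vℛ : V ℛ
  Vℛ = proj₁ (proj₂ agreement-set)
  ℛ-elim : ∀ {s} → s ϵ ℛ → ∃[ q ] ∃[ p ] (s ≋ ⟨ q , p ⟩ × Agreement q p)
  ℛ-elim = proj₁ (proj₂ (proj₂ agreement-set))
  ℛ-intro : ∀ {q 𝒜} → V q → Condition 𝒜 → Agrees q 𝒜 → ⟨ q , code 𝒜 ⟩ ϵ ℛ
  ℛ-intro = proj₂ (proj₂ (proj₂ agreement-set))

  Agreement-resp : ∀ {q p q′ p′} → q ≋ q′ → p ≋ p′ → Agreement q p → Agreement q′ p′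
  Agreement-resp e e′ ag = record
    { 𝒜 = 𝒜 ; is-code = ≋-trans (≋-sym e′) is-code ; condition = condition
    ; agrees = Agrees-⊆ (ϵ-respʳ (≋-sym e)) agrees }
    where open Agreement ag

  ℛ-agreement : ∀ {q p} → ⟨ q , p ⟩ ϵ ℛ → Agreement q p
  ℛ-agreement qp = let _ , _ , e , ag = ℛ-elim qp in
    Agreement-resp (≋-sym (⟨⟩-injˡ e)) (≋-sym (⟨⟩-injʳ e)) ag

  named : ∀ {s} → s ϵ ℛ → 𝕍
  named sϵ = ⟨ check (proj₁ (ℛ-elim sϵ)) , proj₁ (proj₂ (ℛ-elim sϵ)) ⟩

  abstract
    -- Each `q` occurring in `ℛ` is in its transitive closure, so the single parameter `graph ℛ`
    -- gives the replacement formula access to all the names `check q`.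
    names : ∃[ τ ] (V τ × (∀ {z} → z ϵ τ → ∃[ s ] Σ[ sϵ ∈ s ϵ ℛ ] z ≋ named sϵ)
                        × (∀ {s} (sϵ : s ϵ ℛ) → named sϵ ϵ τ))
    names = image (∃⟨⟩ 1F (∃⟨⟩ 2F (0F ≈ᶠ 2F ∧ᶠ ⟪ 3F , 1F ⟫∈ᶠ 6F)))
      (Vgraph ∷ []) Vℛ named V-named
      (λ sϵ → let q , p , e , _ = ℛ-elim sϵ in
        q , p , e , check q , p , ≋-refl , ≋-refl , in-graph sϵ)
      λ { sϵ (q , p , e , w , p′ , e′ , r , h) →
        let _ , _ , e″ , _ = ℛ-elim sϵ ; d = ≋-trans (≋-sym e) e″ in
        ≋-trans e′ (⟨⟩-cong (≋-trans (Checks-sound (graph-checks ℛ) q h) (check-cong (⟨⟩-injˡ d)))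
          (≋-trans r (⟨⟩-injʳ d))) }
      where
      Vp₀ : V p₀
      Vp₀ = K⊆V (proj₁ Cond-p₀)
      Vgraph : V (graph ℛ)
      Vgraph = V-graph M Vp₀ ℛ Vℛ
      in-graph : ∀ {s} (sϵ : s ϵ ℛ) →
        ⟨ proj₁ (ℛ-elim sϵ) , check (proj₁ (ℛ-elim sϵ)) ⟩ ϵ graph ℛ
      in-graph sϵ = let q , p , e , _ = ℛ-elim sϵ in
        graph-mono {ℛ} sϵ (graph-mono (ϵ-respʳ (≋-sym e) (｛｝-introˡ ≋-refl))
          (graph-mono {｛ q , q ｝} (｛｝-introˡ ≋-refl) graph-self))
      V-named : ∀ {s} (sϵ : s ϵ ℛ) → V (named sϵ)
      V-named sϵ = let q , p , e , _ = ℛ-elim sϵ in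
        V-⟨⟩ (V-snd (V-elem Vgraph (in-graph sϵ))) (V-snd (V-resp e (V-elem Vℛ sϵ)))

  τ H : 𝕍
  τ = proj₁ names
  H = val G τ

  τ-name : IsName (ℭ L K X) τ
  τ-name = name λ e e∈ →
    let s , sϵ , z = proj₁ (proj₂ (proj₂ names)) (el e∈)
        q , p , _ , ag = ℛ-elim sϵ
    in check q , p , un≋ z
      , Condition⇒Cond (Agreement.is-code ag) (Agreement.condition ag) , check-name Cond-p₀ q

  H-intro : ∀ {q 𝒜} → V q → Condition 𝒜 → Agrees q 𝒜 → code 𝒜 ϵ G → q ϵ H
  H-intro {q} {𝒜} Vq C𝒜 ag inG =
    let sϵ = ℛ-intro Vq C𝒜 ag
        q′ , p′ , e , _ = ℛ-elim sϵ
    in ϵ-respˡ (≋-trans (val-check p₀ϵG q′) (≋-sym (⟨⟩-injˡ e)))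
         (val-intro {τ} (proj₂ (proj₂ (proj₂ names)) sϵ) (ϵ-respˡ (⟨⟩-injʳ e) inG))

  H-elim : ∀ {q} → q ϵ H → V q × (∃[ p ] (p ϵ G × Agreement q p))
  H-elim qϵ =
    let σ , p , στ , pϵ , v = val-elim {τ} qϵ
        s , sϵ , z = proj₁ (proj₂ (proj₂ names)) στ
        q′ , p′ , e , ag = ℛ-elim sϵ
        q≋ = ≋-trans v (≋-trans (val-cong _ _ (⟨⟩-injˡ z)) (val-check p₀ϵG q′))
    in V-resp (≋-sym q≋) (V-fst (V-resp e (V-elem Vℛ sϵ)))
       , p , pϵ , Agreement-resp (≋-sym q≋) (≋-sym (⟨⟩-injʳ z)) ag

  -- The conditions with which some member of `D` agrees form a set of V, dense by the extension
  -- hypothesis, so G meets it. Assuming this instead of density of `D` in `Cohen X` also covers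
  -- {∅}, which yields nonemptiness of `H`.
  meets-H : ∀ {D} → V D →
    (∀ {𝒜} → Condition 𝒜 → Extension 𝒜 (λ 𝒜′ → ∃[ d ] (d ϵ D × Agrees d 𝒜′))) →
    ∃[ d ] (d ϵ H × d ϵ D)
  meets-H {D} VD ext = hit (meets E VE (conds , dense))
    where
    separated : ∃[ E ] (V E
      × (∀ {z} → z ϵ E → z ϵ P × (∃[ q ] (q ϵ D × ⟨ q , z ⟩ ϵ ℛ)))
      × (∀ {z} → z ϵ P → ∃[ q ] (q ϵ D × ⟨ q , z ⟩ ϵ ℛ) → z ϵ E))
    separated = separate (∃∈ 1F (⟪ 0F , 1F ⟫∈ᶠ 3F)) {D ∷ ℛ ∷ []} (VD ∷ Vℛ ∷ [])
      (proj₁ (proj₂ condition-set))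
    E : 𝕍
    E = proj₁ separated
    VE : V E
    VE = proj₁ (proj₂ separated)
    E-elim : ∀ {p} → p ϵ E → ∃[ q ] (q ϵ D × ⟨ q , p ⟩ ϵ ℛ)
    E-elim pϵ = proj₂ (proj₁ (proj₂ (proj₂ separated)) pϵ)
    conds : ∀ p → p ∈ E → Cond p
    conds p p∈ = let q , _ , s = E-elim (el p∈) ; ag = ℛ-agreement s in
      Condition⇒Cond (Agreement.is-code ag) (Agreement.condition ag)
    dense : ∀ p → Cond p → ∃[ e ] (e ∈ E × e ⊑ p)
    dense p Cp with Cond⇒Condition Cp
    ... | 𝒜 , p≋ , C𝒜 with ext C𝒜
    ...   | 𝒜′ , C𝒜′ , s , d , dϵ , ag = code 𝒜′
      , unϵ (proj₂ (proj₂ (proj₂ separated)) (proj₂ (proj₂ (proj₂ condition-set)) C𝒜′)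
               (d , dϵ , ℛ-intro (V-elem VD dϵ) C𝒜′ ag))
      , 𝒜′ , 𝒜 , ≈-refl (code 𝒜′) , un≋ p≋ , ≼⇒Substructure (proj₁ C𝒜) s
    hit : ∃[ p ] (p ∈ G × p ∈ E) → ∃[ d ] (d ϵ H × d ϵ D)
    hit (p , p∈G , p∈E) =
      let q , qϵ , s = E-elim (el p∈E)
          ag = ℛ-agreement s
      in q , H-intro (V-elem VD qϵ) (Agreement.condition ag) (Agreement.agrees ag)
               (ϵ-respˡ (Agreement.is-code ag) (el p∈G)) , qϵ

  common : ∀ {p q s t} → s ϵ G → t ϵ G → Agreement p s → Agreement q t →
    ∃[ 𝒜 ] (Condition 𝒜 × code 𝒜 ϵ G × Agrees p 𝒜 × Agrees q 𝒜)
  common sϵ tϵ ag ag′ with directed _ _ (unϵ sϵ) (unϵ tϵ)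
  ... | r , r∈ , r≤s , r≤t with Cond⇒Condition (conditions r r∈)
  ...   | 𝒜 , r≋ , C𝒜 = 𝒜 , C𝒜 , ϵ-respˡ r≋ (el r∈)
    , Agrees-mono (⊑⇒≼ r≤s r≋ (Agreement.is-code ag)) (Agreement.agrees ag)
    , Agrees-mono (⊑⇒≼ r≤t r≋ (Agreement.is-code ag′)) (Agreement.agrees ag′)

  -- `Cohen X` is defined in the ambient universe; this brings a weaker condition back into V for
  -- upward closure.
  V-Finite : ∀ {q} → Finite q → (∀ {e} → e ϵ q → V e) → V q
  V-Finite {q} (n , v , p) Ve = V-resp (≋-sym (eq p))
    (V-finite v λ i → Ve (ϵ-respʳ (≋-sym (eq p)) (elemϵ {enum v} i)))

  H-generic : Generic V (Cohen X) H
  H-generic = record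
    { conditions = λ q q∈ → let _ , _ , _ , ag = H-elim (el q∈) in
        Cohen-condition (Agreement.condition ag) (Agreement.agrees ag)
    ; nonempty = let d , dϵ , _ = meets-H (V-｛｝ V-∅ V-∅) λ C𝒜 →
                       let 𝒜′ , C𝒜′ , s , ag = force-base C𝒜 in
                       𝒜′ , C𝒜′ , s , ∅ , ｛｝-introˡ ≋-refl , ag
                 in d , unϵ dϵ
    ; upward = λ p q p∈ Cq q⊆p →
        let Vp , s , sϵ , ag = H-elim (el p∈)
            sub′ : ∀ {e} → e ϵ q → e ϵ p
            sub′ eϵ = el (q⊆p _ (unϵ eϵ))
        in unϵ (H-intro (V-Finite (proj₁ Cq) (V-elem Vp ∘ sub′)) (Agreement.condition ag)
             (Agrees-⊆ sub′ (Agreement.agrees ag)) (ϵ-respˡ (Agreement.is-code ag) sϵ))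
    ; directed = λ p q p∈ q∈ →
        let Vp , s , sϵ , ag = H-elim (el p∈)
            Vq , t , tϵ , ag′ = H-elim (el q∈)
            𝒜 , C𝒜 , inG , (base , agp) , (_ , agq) = common sϵ tϵ ag ag′
        in p ∪ q
           , unϵ (H-intro (V-∪ Vp Vq) C𝒜 (base , λ e eϵ → [ agp e , agq e ]′ (∪-elim eϵ)) inG)
           , (λ e e∈ → unϵ (∪-introˡ {p} {q} (el e∈)))
           , (λ e e∈ → unϵ (∪-introʳ {p} {q} (el e∈)))
    ; meets = λ D VD dense → let d , dϵH , dϵD = meets-H VD (force-dense dense) in
        d , unϵ dϵH , unϵ dϵD
    }

  H-exists : ∃[ H ] ((V [ ℭ L K X ∣ G ]) H × Generic V (Cohen X) H)
  H-exists = H , (τ , proj₁ (proj₂ names) , τ-name , ≈-refl H) , H-generic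

-- If no element of `X` is new, the points already chosen enumerate `X`.
infinite⇒distinct : ExcludedMiddle (lsuc 0ℓ) → ∀ {X} → ¬ Finite X → ∀ n →
  Σ[ c ∈ (Fin n → 𝕍) ] ((∀ i → c i ϵ X) × Distinct c)
infinite⇒distinct em inf zero = (λ ()) , (λ ()) , λ ()
infinite⇒distinct em {X} inf (suc n) with infinite⇒distinct em inf n
... | c , cϵ , dc with em {∃[ x ] (x ϵ X × (∀ i → ¬ x ≋ c i))}
...   | yes (x , xϵ , new) = x ◂ c , (λ { zero → xϵ ; (suc i) → cϵ i }) , λ
  { zero    zero    _ → refl
  ; zero    (suc j) e → ⊥-elim (new j e)
  ; (suc i) zero    e → ⊥-elim (new i (≋-sym e))
  ; (suc i) (suc j) e → cong suc (dc i j e) }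
...   | no none = ⊥-elim (inf (n , c , un≋ (≋-ext {X} {enum c} covered
          (λ { (el (i , p)) → ϵ-respˡ (≋-sym (eq p)) (cϵ i) }))))
  where
  covered : ∀ {x} → x ϵ X → x ϵ enum c
  covered {x} xϵ with em {Σ[ i ∈ Fin n ] x ≋ c i}
  ... | yes (i , p) = memb {enum c} i p
  ... | no ¬p = ⊥-elim (none (x , xϵ , λ i p → ¬p (i , p)))

proposition4p4 : ExcludedMiddle (lsuc 0ℓ) →
    (V : Class) → IsTransitiveModel V →
    (X : 𝕍) → V X → ¬ Finite X →
    (L : 𝕍) → V L → IsLanguage L →
    (K : Class) → IsClassOf V K → StrongFraïssé V L K → ¬ Trivial L K →
    (G : 𝕍) → Generic V (ℭ L K X) G →
    ∃[ H ] ((V [ ℭ L K X ∣ G ]) H × Generic V (Cohen X) H)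
proposition4p4 em V M X VX infinite L VL _ K isClass SF nontrivial G gen =
  let m , split = Nontrivial.splitting em M VL isClass SF nontrivial
      c , cϵX , dc = infinite⇒distinct em infinite m
  in GenericExtension.H-exists em M VX VL isClass SF split cϵX dc gen
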